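{- Let $\mathcal{S}$ be a sound and refutationally complete saturation system. Then for all natural numbers $0<n<m$, the system $\mathcal{S}+\mathrm{Literal}\text{ - }\mathrm{AIND}^R_2$ refutes neither the clause set $\mathcal{X}_m$ nor the clause set $\mathcal{Y}_{m,n}$.
   Context: Language of linear arithmetic $\{0/0,s/1,p/1,+/2\}$. $\mathcal{T}'$ has axioms (universally closed) $0\neq s(x)$, $p(0)=0$, $p(s(x))=x$, $x+0=x$, $x+s(y)=s(x+y)$, $x\neq0\to x=s(p(x))$, $x+y=y+x$, $(x+y)+z=x+(y+z)$, $x+y=x+z\to y=z$. $m\cdot t$ is $t+(t+\cdots+(t+t)\cdots)$ ($m$ copies), $s^n$ is $n$-fold $s$. $C_m=\forall x,y(m\cdot x=m\cdot y\to x=y)$, $D_{m,n}=\forall x,y\,(s^n(m\cdot x)\neq m\cdot y)$; $\mathcal{X}_m=\mathit{CNF}(\mathit{sk}^\exists(\mathcal{T}'+\neg C_m))$, $\mathcal{Y}_{m,n}=\mathit{CNF}(\mathit{sk}^\exists(\mathcal{T}'+\neg D_{m,n}))$. Skolemization $\mathit{sk}^\exists$/$\mathit{sk}^\forall$ uses canonical Skolem symbols: a strong quantifier $QxA$ with free variables $\vec y$ is replaced by $\mathfrak{s}_{QxA}(\vec y)$, a new function symbol indexed by $QxA$ ($\mathit{sk}^Q$ fixes atoms, commutes with $\wedge,\vee$, $\mathit{sk}^Q(\neg A)=\neg\mathit{sk}^{\overline Q}(A)$, eliminates quantifiers $Q$ and keeps quantifiers $\overline Q$). $\mathit{CNF}$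 gives clause sets of conjunctive normal forms; $\mathcal{E}\vee C=\{E\cup C:E\in\mathcal{E}\}$. Saturation systems: sets of rules $\mathcal{C}/\mathcal{D}$ ($\mathcal{C}$ clause set, $\mathcal{D}$ finite clause set), $+$ = union; a deduction from $\mathcal{C}_0$ is $\mathcal{D}_0=\mathcal{C}_0,\dots,\mathcal{D}_k$ with $\mathcal{D}_{i+1}=\mathcal{D}_i\cup\mathcal{B}_i$ for a rule $\mathcal{D}_i/\mathcal{B}_i$; a refutation has the empty clause in $\mathcal{D}_k$. Sound: any clause $C$ derivable from $\mathcal{C}_0$ has $L(C)\subseteq L(\mathcal{C}_0)$ and $\mathcal{C}_0\models C$; refutationally complete: every inconsistent clause set has a refutation. $\mathrm{Literal}\text{ - }\mathrm{AIND}^R_2$: from a clause set containing a clause $\overline{l}(a,a)\vee C$, where $l(x,y)$ is a literal, $a$ is a constant, $l(a,a)$ is ground and $\overline{l}$ denotes the complementary literal, derive $\mathit{CNF}(\neg\,\mathit{sk}^\forall(l(0,a)\wedge\forall x(l(x,a)\to l(s(x),a))))\vee C$, i.e. the clauses $\{\neg l(0,a),l(\sigma,a)\}\cup C$ and $\{\neg l(0,a),\neg l(s(\sigma),a)\}\cup C$ with $\sigma=\mathfrak{s}_{\forall x(l(x,a)\to l(s(x),a))}$. -}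

module Defs where

open import Level using (Level; _⊔_; 0ℓ) renaming (suc to lsuc)
open import Data.Bool using (Bool; true; false; not)
open import Data.Fin using (Fin; zero; suc; #_)
open import Data.Fin.Subset using (Subset; inside; outside; ⁅_⁆; ∣_∣) renaming (_∪_ to _∪ₛ_; ⊥ to ∅ₛ)
open import Data.List using (List; []; _∷_; [_]; _++_; map; concatMap; cartesianProductWith)
open import Data.List.Membership.Propositional using (_∈_)
open import Data.List.Relation.Binary.Subset.Propositional using (_⊆_)
open import Data.List.Relation.Unary.Any using (Any)
open import Data.Nat using (ℕ; zero; suc) renaming (_+_ to _+ℕ_)
open import Data.Product using (∃-syntax; _×_; _,_)
open import Data.Sum using (_⊎_)
open import Data.Vec using (Vec; []; _∷_; tail) renaming (map to mapᵥ)
open import Data.Vec.Relation.Binary.Pointwise.Inductive using (Pointwise)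
open import Relation.Binary using (Rel; IsEquivalence)
open import Relation.Nullary using (¬_)

-- Function and predicate symbols available to a saturation system besides
-- 0, s, p, +, the canonical Skolem symbols and equality.
record Signature : Set₁ where
  field
    Op  : ℕ → Set
    Pre : ℕ → Set

data Quantifier : Set where
  all ex : Quantifier

dual : Quantifier → Quantifier
dual all = ex
dual ex  = all

module FirstOrder (𝔏 : Signature) where
  open Signature 𝔏

  private variable
    V W : Set
    n k : ℕ

  infix  7 _≐_
  infixr 6 _∧_
  infixr 5 _∨_
  infixr 4 _⇒_

  data Fun : ℕ → Set
  data Term (V : Set) : Set
  data Atom (V : Set) : Set
  data Formula : ℕ → Set

  data Fun where
    `0 : Fun 0
    `s : Fun 1
    `p : Fun 1
    `+ : Fun 2
    op : Op k → Fun k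
    -- skolem Q A is the Skolem symbol 𝔰_{QxA}; A may itself contain
    -- Skolem symbols.
    skolem : Quantifier → Formula (suc n) → Fun n

  data Term V where
    var : V → Term V
    app : Fun k → Vec (Term V) k → Term V

  data Atom V where
    _≐_ : Term V → Term V → Atom V
    rel : Pre k → Vec (Term V) k → Atom V

  -- De Bruijn indices: Formula n has its free variables in Fin n, and
  -- quant binds index zero.
  data Formula where
    atom    : Atom (Fin n) → Formula n
    neg     : Formula n → Formula n
    _∧_ _∨_ : Formula n → Formula n → Formula n
    quant   : Quantifier → Formula (suc n) → Formula n

  _⇒_ : Formula n → Formula n → Formula n
  A ⇒ B = neg A ∨ B

  const : Fun 0 → Term V
  const c = app c []

  𝟎 : Term V
  𝟎 = const `0

  s p : Term V → Term V
  s t = app `s (t ∷ [])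
  p t = app `p (t ∷ [])

  infixl 8 _⊕_
  _⊕_ : Term V → Term V → Term V
  t ⊕ u = app `+ (t ∷ u ∷ [])

  -- Skolem symbols are atomic: substitution does not enter their index.
  substₜ  : (V → Term W) → Term V → Term W
  substₜₛ : (V → Term W) → Vec (Term V) k → Vec (Term W) k
  substₜ ρ (var x)    = ρ x
  substₜ ρ (app f ts) = app f (substₜₛ ρ ts)
  substₜₛ ρ []       = []
  substₜₛ ρ (t ∷ ts) = substₜ ρ t ∷ substₜₛ ρ ts

  substₐ : (V → Term W) → Atom V → Atom W
  substₐ ρ (t ≐ u)    = substₜ ρ t ≐ substₜ ρ u
  substₐ ρ (rel P ts) = rel P (substₜₛ ρ ts)

  weaken : Term (Fin n) → Term (Fin (suc n))
  weaken = substₜ (λ i → var (suc i))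

  infixr 5 _▸_
  _▸_ : Term V → (Fin n → Term V) → Fin (suc n) → Term V
  (t ▸ ρ) zero    = t
  (t ▸ ρ) (suc i) = ρ i

  lift : (Fin n → Term (Fin k)) → Fin (suc n) → Term (Fin (suc k))
  lift ρ = var zero ▸ λ i → weaken (ρ i)

  substᶠ : (Fin n → Term (Fin k)) → Formula n → Formula k
  substᶠ ρ (atom A)    = atom (substₐ ρ A)
  substᶠ ρ (neg A)     = neg (substᶠ ρ A)
  substᶠ ρ (A ∧ B)     = substᶠ ρ A ∧ substᶠ ρ B
  substᶠ ρ (A ∨ B)     = substᶠ ρ A ∨ substᶠ ρ B
  substᶠ ρ (quant Q A) = quant Q (substᶠ (lift ρ) A)

  freeₜ  : Term (Fin n) → Subset n
  freeₜₛ : Vec (Term (Fin n)) k → Subset n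
  freeₜ (var i)    = ⁅ i ⁆
  freeₜ (app f ts) = freeₜₛ ts
  freeₜₛ []       = ∅ₛ
  freeₜₛ (t ∷ ts) = freeₜ t ∪ₛ freeₜₛ ts

  freeₐ : Atom (Fin n) → Subset n
  freeₐ (t ≐ u)    = freeₜ t ∪ₛ freeₜ u
  freeₐ (rel P ts) = freeₜₛ ts

  free : Formula n → Subset n
  free (atom A)    = freeₐ A
  free (neg A)     = free A
  free (A ∧ B)     = free A ∪ₛ free B
  free (A ∨ B)     = free A ∪ₛ free B
  free (quant Q A) = tail (free A)

  members : (q : Subset n) → Vec (Fin n) ∣ q ∣
  members []            = []
  members (inside  ∷ q) = zero ∷ mapᵥ suc (members q)
  members (outside ∷ q) = mapᵥ suc (members q)

  -- Renumbers the variables in q consecutively.  It is only applied to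
  -- formulas with free variables in q, so the value 𝟎 is never used.
  compress : (q : Subset n) → Fin n → Term (Fin ∣ q ∣)
  compress (inside  ∷ q) = lift (compress q)
  compress (outside ∷ q) = 𝟎 ▸ compress q

  -- 𝔰_{QxA}(y⃗), where y⃗ are exactly the free variables of QxA.
  skolemTerm : Quantifier → Formula (suc n) → Term (Fin n)
  skolemTerm Q A = app (skolem Q (substᶠ (lift (compress q)) A)) (mapᵥ var (members q))
    where q = free (quant Q A)

  -- skolemize Q ρ A is sk^Q(Aρ).  Carrying ρ makes the clause
  -- sk^Q(QxA) = sk^Q(A[x / 𝔰_{QxA}(y⃗)]) structurally recursive.
  skolemize : Quantifier → (Fin n → Term (Fin k)) → Formula n → Formula k
  skolemize Q   ρ (atom A)      = atom (substₐ ρ A)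
  skolemize Q   ρ (neg A)       = neg (skolemize (dual Q) ρ A)
  skolemize Q   ρ (A ∧ B)       = skolemize Q ρ A ∧ skolemize Q ρ B
  skolemize Q   ρ (A ∨ B)       = skolemize Q ρ A ∨ skolemize Q ρ B
  skolemize all ρ (quant all A) = skolemize all (skolemTerm all (substᶠ (lift ρ) A) ▸ ρ) A
  skolemize ex  ρ (quant ex A)  = skolemize ex (skolemTerm ex (substᶠ (lift ρ) A) ▸ ρ) A
  skolemize all ρ (quant ex A)  = quant ex (skolemize all (lift ρ) A)
  skolemize ex  ρ (quant all A) = quant all (skolemize ex (lift ρ) A)

  sk : Quantifier → Formula n → Formula n
  sk Q = skolemize Q var

  data Literal (V : Set) : Set where
    pos : Atom V → Literal V
    neg : Atom V → Literal V

  complement : Literal V → Literal V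
  complement (pos A) = neg A
  complement (neg A) = pos A

  substₗ : (V → Term W) → Literal V → Literal W
  substₗ ρ (pos A) = pos (substₐ ρ A)
  substₗ ρ (neg A) = neg (substₐ ρ A)

  literal : Literal (Fin n) → Formula n
  literal (pos A) = atom A
  literal (neg A) = neg (atom A)

  -- A clause is a finite set of literals, so lists are compared by _≈ᶜ_;
  -- its variables are implicitly universally quantified.
  Clause : Set
  Clause = List (Literal ℕ)

  _≈ᶜ_ : Clause → Clause → Set
  C ≈ᶜ D = C ⊆ D × D ⊆ C

  ClauseSet : Set₁
  ClauseSet = Clause → Set

  _∈ᶜ_ : Clause → ClauseSet → Set
  C ∈ᶜ 𝒞 = ∃[ D ] 𝒞 D × C ≈ᶜ D

  _≈ˢ_ : ClauseSet → ClauseSet → Set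
  𝒞 ≈ˢ 𝒟 = (∀ C → C ∈ᶜ 𝒞 → C ∈ᶜ 𝒟) × (∀ C → C ∈ᶜ 𝒟 → C ∈ᶜ 𝒞)

  finite : List Clause → ClauseSet
  finite 𝒞 C = C ∈ 𝒞

  _∪_ : ClauseSet → ClauseSet → ClauseSet
  (𝒞 ∪ 𝒟) C = 𝒞 C ⊎ 𝒟 C

  -- 𝒞 ∨ D
  _⊻_ : List Clause → Clause → List Clause
  𝒞 ⊻ D = map (_++ D) 𝒞

  quantifiers : Formula n → ℕ
  quantifiers (atom A)    = 0
  quantifiers (neg A)     = quantifiers A
  quantifiers (A ∧ B)     = quantifiers A +ℕ quantifiers B
  quantifiers (A ∨ B)     = quantifiers A +ℕ quantifiers B
  quantifiers (quant Q A) = suc (quantifiers A)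

  bind : ℕ → (Fin n → ℕ) → Fin (suc n) → ℕ
  bind v η zero    = v
  bind v η (suc i) = η i

  -- Clauses of A (sign true) or ¬A (sign false).  The input has only
  -- universal quantifiers in positive and existential quantifiers in negative
  -- position (with respect to the sign); they are dropped, and their variables
  -- become distinct clause variables v, v + 1, ….
  clauses : Bool → (v : ℕ) → (Fin n → ℕ) → Formula n → List Clause
  clauses true  v η (atom A)    = [ [ pos (substₐ (λ i → var (η i)) A) ] ]
  clauses false v η (atom A)    = [ [ neg (substₐ (λ i → var (η i)) A) ] ]
  clauses b     v η (neg A)     = clauses (not b) v η A
  clauses true  v η (A ∧ B)     = clauses true v η A ++ clauses true (v +ℕ quantifiers A) η B
  clauses false v η (A ∧ B)     =
    cartesianProductWith _++_ (clauses false v η A) (clauses false (v +ℕ quantifiers A) η B)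
  clauses true  v η (A ∨ B)     =
    cartesianProductWith _++_ (clauses true v η A) (clauses true (v +ℕ quantifiers A) η B)
  clauses false v η (A ∨ B)     = clauses false v η A ++ clauses false (v +ℕ quantifiers A) η B
  clauses b     v η (quant Q A) = clauses b (suc v) (bind v η) A

  cnf : Formula 0 → List Clause
  cnf = clauses true 0 (λ ())

  -- CNF(sk^∃(𝒯)) for a finite theory 𝒯.
  cnf-sk : List (Formula 0) → ClauseSet
  cnf-sk 𝒯 = finite (concatMap (λ A → cnf (sk ex A)) 𝒯)

  data Symbol : Set where
    fun : Fun k → Symbol
    pre : Pre k → Symbol

  symbolsₜ  : Term V → List Symbol
  symbolsₜₛ : Vec (Term V) k → List Symbol
  symbolsₜ (var x)    = []
  symbolsₜ (app f ts) = fun f ∷ symbolsₜₛ ts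
  symbolsₜₛ []       = []
  symbolsₜₛ (t ∷ ts) = symbolsₜ t ++ symbolsₜₛ ts

  symbolsₐ : Atom V → List Symbol
  symbolsₐ (t ≐ u)    = symbolsₜ t ++ symbolsₜ u
  symbolsₐ (rel P ts) = pre P ∷ symbolsₜₛ ts

  symbolsₗ : Literal V → List Symbol
  symbolsₗ (pos A) = symbolsₐ A
  symbolsₗ (neg A) = symbolsₐ A

  symbols : Clause → List Symbol
  symbols = concatMap symbolsₗ

  -- L(C) ⊆ L(𝒞)
  _⊆ᴸ_ : Clause → ClauseSet → Set
  C ⊆ᴸ 𝒞 = ∀ f → f ∈ symbols C → ∃[ D ] 𝒞 D × f ∈ symbols D

  -- Equality is interpreted by a congruence, in place of identity on the
  -- quotient.  The constant 0 makes the carrier nonempty.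
  record Structure : Set₁ where
    infix 4 _≈_
    field
      Carrier       : Set
      _≈_           : Rel Carrier 0ℓ
      isEquivalence : IsEquivalence _≈_
      ⟦_⟧           : Fun k → Vec Carrier k → Carrier
      ⟦⟧-cong       : (f : Fun k) {xs ys : Vec Carrier k} →
                      Pointwise _≈_ xs ys → ⟦ f ⟧ xs ≈ ⟦ f ⟧ ys
      ⟦_⟧ᴾ          : Pre k → Vec Carrier k → Set
      ⟦⟧ᴾ-resp      : (P : Pre k) {xs ys : Vec Carrier k} →
                      Pointwise _≈_ xs ys → ⟦ P ⟧ᴾ xs → ⟦ P ⟧ᴾ ys

    value  : (V → Carrier) → Term V → Carrier
    values : (V → Carrier) → Vec (Term V) k → Vec Carrier k
    value ρ (var x)    = ρ x
    value ρ (app f ts) = ⟦ f ⟧ (values ρ ts)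
    values ρ []       = []
    values ρ (t ∷ ts) = value ρ t ∷ values ρ ts

    Trueₐ : (V → Carrier) → Atom V → Set
    Trueₐ ρ (t ≐ u)    = value ρ t ≈ value ρ u
    Trueₐ ρ (rel P ts) = ⟦ P ⟧ᴾ (values ρ ts)

    Trueₗ : (V → Carrier) → Literal V → Set
    Trueₗ ρ (pos A) = Trueₐ ρ A
    Trueₗ ρ (neg A) = ¬ Trueₐ ρ A

  -- The double negation gives the disjunction in a clause its classical
  -- meaning, so that all classically valid inferences are sound.
  _⊨ᶜ_ : Structure → Clause → Set
  M ⊨ᶜ C = ∀ (ρ : ℕ → Carrier) → ¬ ¬ Any (Trueₗ ρ) C
    where open Structure M

  _⊨ˢ_ : Structure → ClauseSet → Set
  M ⊨ˢ 𝒞 = ∀ C → 𝒞 C → M ⊨ᶜ C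

  _⊨_ : ClauseSet → Clause → Set₁
  𝒞 ⊨ C = ∀ M → M ⊨ˢ 𝒞 → M ⊨ᶜ C

  Inconsistent : ClauseSet → Set₁
  Inconsistent 𝒞 = ∀ M → ¬ (M ⊨ˢ 𝒞)

  private variable
    a b : Level

  -- S 𝒞 ℬ: the rule 𝒞/ℬ belongs to S.
  SaturationSystem : (a : Level) → Set (lsuc 0ℓ ⊔ lsuc a)
  SaturationSystem a = ClauseSet → List Clause → Set a

  infixl 6 _+_
  _+_ : SaturationSystem a → SaturationSystem b → SaturationSystem (a ⊔ b)
  (S + T) 𝒞 ℬ = S 𝒞 ℬ ⊎ T 𝒞 ℬ

  -- Deduction S 𝒞₀ 𝒟: deductions from 𝒞₀ whose last clause set is 𝒟.
  data Deduction (S : SaturationSystem a) (𝒞₀ : ClauseSet) : ClauseSet → Set (lsuc 0ℓ ⊔ a) where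
    start : Deduction S 𝒞₀ 𝒞₀
    step  : ∀ {𝒟 𝒞 ℬ} → Deduction S 𝒞₀ 𝒟 → 𝒞 ≈ˢ 𝒟 → S 𝒞 ℬ → Deduction S 𝒞₀ (𝒟 ∪ finite ℬ)

  Derives : SaturationSystem a → ClauseSet → Clause → Set (lsuc 0ℓ ⊔ a)
  Derives S 𝒞₀ C = ∃[ 𝒟 ] Deduction S 𝒞₀ 𝒟 × C ∈ᶜ 𝒟

  Refutes : SaturationSystem a → ClauseSet → Set (lsuc 0ℓ ⊔ a)
  Refutes S 𝒞₀ = Derives S 𝒞₀ []

  Sound : SaturationSystem a → Set (lsuc 0ℓ ⊔ a)
  Sound S = ∀ 𝒞₀ C → Derives S 𝒞₀ C → C ⊆ᴸ 𝒞₀ × 𝒞₀ ⊨ C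

  -- The existence of a refutation is classical: without ¬ ¬ this would imply
  -- excluded middle, as is seen from clause sets { [] | P } for arbitrary P.
  RefutationallyComplete : SaturationSystem a → Set (lsuc 0ℓ ⊔ a)
  RefutationallyComplete S = ∀ 𝒞 → Inconsistent 𝒞 → ¬ ¬ Refutes S 𝒞

  -- l(t, u), where x is index 0 and y is index 1.
  infix 9 _⟨_,_⟩
  _⟨_,_⟩ : Literal (Fin 2) → Term V → Term V → Literal V
  l ⟨ t , u ⟩ = substₗ (t ▸ u ▸ λ ()) l

  -- l(0,a) ∧ ∀x (l(x,a) → l(s(x),a))
  inductionPremise : Literal (Fin 2) → Fun 0 → Formula 0
  inductionPremise l a =
    literal (l ⟨ 𝟎 , const a ⟩) ∧
    quant all (literal (l ⟨ var zero , const a ⟩) ⇒ literal (l ⟨ s (var zero) , const a ⟩))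

  -- l(a,a) is ground since l has no variables besides x and y.
  data LiteralAIND₂ (𝒞 : ClauseSet) : List Clause → Set where
    aind : (l : Literal (Fin 2)) (a : Fun 0) (C : Clause) →
           (complement (l ⟨ const a , const a ⟩) ∷ C) ∈ᶜ 𝒞 →
           LiteralAIND₂ 𝒞 (cnf (neg (sk all (inductionPremise l a))) ⊻ C)

  _≐ᶠ_ _≠ᶠ_ : Term (Fin n) → Term (Fin n) → Formula n
  t ≐ᶠ u = atom (t ≐ u)
  t ≠ᶠ u = neg (t ≐ᶠ u)
  infix 7 _≐ᶠ_ _≠ᶠ_

  ∀-closure : Formula n → Formula 0
  ∀-closure {zero}  A = A
  ∀-closure {suc n} A = ∀-closure (quant all A)

  𝒯′ : List (Formula 0)
  𝒯′ =
      ∀-closure {1} (𝟎 ≠ᶠ s x₁)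
    ∷ p 𝟎 ≐ᶠ 𝟎
    ∷ ∀-closure {1} (p (s x₁) ≐ᶠ x₁)
    ∷ ∀-closure {1} (x₁ ⊕ 𝟎 ≐ᶠ x₁)
    ∷ ∀-closure {2} (x₂ ⊕ s y₂ ≐ᶠ s (x₂ ⊕ y₂))
    ∷ ∀-closure {1} (x₁ ≠ᶠ 𝟎 ⇒ x₁ ≐ᶠ s (p x₁))
    ∷ ∀-closure {2} (x₂ ⊕ y₂ ≐ᶠ y₂ ⊕ x₂)
    ∷ ∀-closure {3} ((x ⊕ y) ⊕ z ≐ᶠ x ⊕ (y ⊕ z))
    ∷ ∀-closure {3} (x ⊕ y ≐ᶠ x ⊕ z ⇒ y ≐ᶠ z)
    ∷ []
    where
    x₁ : Term (Fin 1)
    x₁ = var (# 0)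
    x₂ y₂ : Term (Fin 2)
    x₂ = var (# 1)
    y₂ = var (# 0)
    x y z : Term (Fin 3)
    x = var (# 2)
    y = var (# 1)
    z = var (# 0)

  -- m · t = t + (t + ⋯ + (t + t)⋯) with m copies of t; the value for m = 0 is
  -- a convention that is not used.
  infixr 9 _·_
  _·_ : ℕ → Term V → Term V
  zero        · t = 𝟎
  suc zero    · t = t
  suc (suc m) · t = t ⊕ (suc m · t)

  s^ : ℕ → Term V → Term V
  s^ zero    t = t
  s^ (suc n) t = s (s^ n t)

  C[_] : ℕ → Formula 0
  C[ m ] = quant all (quant all (m · x ≐ᶠ m · y ⇒ x ≐ᶠ y))
    where
    x y : Term (Fin 2)
    x = var (# 1)
    y = var (# 0)

  D[_,_] : ℕ → ℕ → Formula 0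
  D[ m , n ] = quant all (quant all (s^ n (m · x) ≠ᶠ m · y))
    where
    x y : Term (Fin 2)
    x = var (# 1)
    y = var (# 0)

  𝒳 : ℕ → ClauseSet
  𝒳 m = cnf-sk (neg C[ m ] ∷ 𝒯′)

  𝒴 : ℕ → ℕ → ClauseSet
  𝒴 m n = cnf-sk (neg D[ m , n ] ∷ 𝒯′)

{-# OPTIONS --safe #-}
-- One structure satisfies 𝒳 m, 𝒴 m n and every instance of the induction rule.  It is the
-- nonnegative part of ℤ × ℤ × ℤ/m, ordered lexicographically by the first two coordinates, with
-- degree 0 restricted to the numerals j · (0 , m , 0).  The torsion refutes C[ m ], and division
-- of 1 by m in positive degree refutes D[ m , n ].
--
-- In any cancellative model, a term t(x) is eventually affine: t(N + x) = αx + β for some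
-- numeral N.  Two such functions that agree at two successive points beyond N agree at all points
-- beyond N.  Hence, if an equation changes its truth value between 0 and some a, it does so
-- between c and s(c) for some c that is a numeral ≤ N or the predecessor of a solution beyond N.
-- This yields a finite list of candidates for the value of the Skolem constant σ of the induction
-- rule, and solvability of linear equations is decidable in the model, so that a value can be
-- chosen by recursion on the formula that indexes σ.
module Submission where

open import Defs
import Algebra.Properties.AbelianGroup as AbelianGroupProperties
import Algebra.Properties.CommutativeMonoid.Mult as Mult
import Algebra.Properties.CommutativeSemigroup as CommutativeSemigroupProperties
open import Algebra.Bundles using (CommutativeMonoid)
open import Data.Bool as Bool using (Bool; true; false; not; if_then_else_)
open import Data.Fin using (Fin; zero; suc; toℕ; fromℕ<)
open import Data.Fin.Properties using (any?; toℕ-fromℕ<)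
open import Data.Fin.Subset using (Subset)
open import Data.Integer as ℤ using (ℤ; +_; -[1+_])
import Data.Integer.DivMod as ℤ
open import Data.Integer.Divisibility.Signed as ℤ using (divides)
import Data.Integer.Properties as ℤ
open import Data.Integer.Tactic.RingSolver using (solve-∀)
open import Data.List using (List; []; _∷_; _++_; map; upTo)
open import Data.List.Membership.Propositional using (_∈_)
open import Data.List.Membership.Propositional.Properties using (∈-++⁺ˡ; ∈-++⁺ʳ; ∈-map⁺; ∈-upTo⁺)
open import Data.List.Relation.Binary.Subset.Propositional.Properties using (⊆-refl; Any-resp-⊆)
open import Data.List.Relation.Unary.Any using (Any; here; there)
open import Data.Nat as ℕ using (ℕ; zero; suc; _<_; _≤_; z≤n; s≤s; NonZero)
import Data.Nat.Divisibility as ℕ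
import Data.Nat.Properties as ℕ
open import Data.Product using (∃-syntax; _×_; _,_; proj₁; proj₂)
open import Data.Sum using (_⊎_; inj₁; inj₂)
open import Data.Unit using (⊤; tt)
open import Data.Vec as Vec using (Vec; []; _∷_)
open import Data.Vec.Relation.Binary.Pointwise.Inductive using (Pointwise; []; _∷_)
open import Function using (_∘_)
open import Level using (Level; 0ℓ)
open import Relation.Binary using (Decidable)
open import Relation.Binary.PropositionalEquality as ≡ using (_≡_)
import Relation.Binary.Reasoning.Setoid as SetoidReasoning
open import Relation.Nullary using (¬_; Dec; yes; no; does; proof; contradiction; _×-dec_; _⊎-dec_)
open import Relation.Nullary.Decidable using (decidable-stable; map′; ¬?)
open import Relation.Nullary.Reflects using (Reflects; ofʸ; ofⁿ; invert; det; ¬-reflects)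
import Relation.Unary as Unary

-- Models of the arithmetic axioms with decidable linear equations.

-- s x is 1# + x, so that numerals n ⊗ 1# satisfy ⌜ suc n ⌝ = s ⌜ n ⌝ on the nose.
record Arithmetic : Set₁ where
  field
    +-commutativeMonoid : CommutativeMonoid 0ℓ 0ℓ

  open CommutativeMonoid +-commutativeMonoid public
    renaming (_∙_ to _+_; ε to 0#; ∙-cong to +-cong; ∙-congˡ to +-congˡ; ∙-congʳ to +-congʳ;
              assoc to +-assoc; comm to +-comm; identityˡ to +-identityˡ; identityʳ to +-identityʳ)
  open Mult +-commutativeMonoid public using () renaming (_×_ to _⊗_)

  field
    1# : Carrier
    p  : Carrier → Carrier

  s : Carrier → Carrier
  s x = 1# + x

  field
    p-cong    : ∀ {x y} → x ≈ y → p x ≈ p y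
    0≉s       : ∀ x → ¬ 0# ≈ s x
    p-0       : p 0# ≈ 0#
    p-s       : ∀ x → p (s x) ≈ x
    s-p       : ∀ {x} → ¬ x ≈ 0# → x ≈ s (p x)
    +-cancelˡ : ∀ x {y z} → x + y ≈ x + z → y ≈ z
    _≟_       : Decidable _≈_
    solve?    : ∀ α β α′ β′ → Dec (∃[ x ] α ⊗ x + β ≈ α′ ⊗ x + β′)

-- Applied to an equation in `candidate-leaving` and to its negation in `candidate-entering`.
first-change : ∀ {P : ℕ → Set} → Unary.Decidable P → P 0 → ∀ k →
               (∀ j → j ≤ k → P j) ⊎ ∃[ j ] j < k × P j × ¬ P (suc j)
first-change P? P0 zero = inj₁ λ { zero z≤n → P0 }
first-change P? P0 (suc k) with first-change P? P0 k
... | inj₂ (j , j<k , Pj , ¬Pj′) = inj₂ (j , ℕ.m<n⇒m<1+n j<k , Pj , ¬Pj′)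
... | inj₁ P≤k with P? (suc k)
...   | no ¬P  = inj₂ (k , ℕ.≤-refl , P≤k k ℕ.≤-refl , ¬P)
...   | yes P′ = inj₁ below
  where
  below : ∀ j → j ≤ suc k → _
  below j j≤ with ℕ.m≤n⇒m<n∨m≡n j≤
  ... | inj₁ (s≤s j≤k) = P≤k j j≤k
  ... | inj₂ ≡.refl    = P′

-- Eventually affine functions.

module EventuallyAffine (𝔸 : Arithmetic) where
  open Arithmetic 𝔸
  open Mult +-commutativeMonoid
    using (×-congʳ; ×-congˡ; ×-homo-1; ×-homo-+; ×-distrib-+)
  open CommutativeSemigroupProperties (CommutativeMonoid.commutativeSemigroup +-commutativeMonoid)
    using (x∙yz≈y∙xz; interchange)
  open SetoidReasoning setoid

  ⌜_⌝ : ℕ → Carrier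
  ⌜ n ⌝ = n ⊗ 1#

  +-cancelʳ : ∀ {x y} z → x + z ≈ y + z → x ≈ y
  +-cancelʳ {x} {y} z x+z≈y+z =
    +-cancelˡ z (trans (+-comm z x) (trans x+z≈y+z (+-comm y z)))

  +-s : ∀ x y → x + s y ≈ s (x + y)
  +-s x y = x∙yz≈y∙xz x 1# y

  -- A nonzero `y` is a successor, and successors move out of sums, so `p` meets no truncation.
  p-+ : ∀ x {y} → ¬ y ≈ 0# → p (x + y) ≈ x + p y
  p-+ x {y} y≉0 = begin
    p (x + y)       ≈⟨ p-cong (+-congˡ (s-p y≉0)) ⟩
    p (x + s (p y)) ≈⟨ p-cong (+-s x (p y)) ⟩
    p (s (x + p y)) ≈⟨ p-s (x + p y) ⟩
    x + p y         ∎

  ⌜⌝-injective : ∀ i j → ⌜ i ⌝ ≈ ⌜ j ⌝ → i ≡ j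
  ⌜⌝-injective zero    zero    _  = ≡.refl
  ⌜⌝-injective zero    (suc j) eq = contradiction eq (0≉s _)
  ⌜⌝-injective (suc i) zero    eq = contradiction (sym eq) (0≉s _)
  ⌜⌝-injective (suc i) (suc j) eq = ≡.cong suc (⌜⌝-injective i j (+-cancelˡ 1# eq))

  ⊗-s : ∀ n x → n ⊗ s x ≈ ⌜ n ⌝ + n ⊗ x
  ⊗-s n x = ×-distrib-+ 1# x n

  -- This replaces comparison with `⌜ N ⌝`, as no order is given. When `N` grows by one, the
  -- remainder `y` is either zero, which makes `x` the numeral `⌜ N ⌝`, or a successor that hands
  -- one unit over.
  below-or-above : ∀ N x → (∃[ j ] j < N × x ≈ ⌜ j ⌝) ⊎ (∃[ y ] x ≈ ⌜ N ⌝ + y)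
  below-or-above zero    x = inj₂ (x , sym (+-identityˡ x))
  below-or-above (suc N) x with below-or-above N x
  ... | inj₁ (j , j<N , x≈j) = inj₁ (j , ℕ.m<n⇒m<1+n j<N , x≈j)
  ... | inj₂ (y , x≈N+y) with y ≟ 0#
  ...   | yes y≈0 = inj₁ (N , ℕ.≤-refl , trans x≈N+y (trans (+-congˡ y≈0) (+-identityʳ _)))
  ...   | no  y≉0 = inj₂ (p y , (begin
    x               ≈⟨ x≈N+y ⟩
    ⌜ N ⌝ + y       ≈⟨ +-congˡ (s-p y≉0) ⟩
    ⌜ N ⌝ + s (p y) ≈⟨ +-s ⌜ N ⌝ (p y) ⟩
    s (⌜ N ⌝ + p y) ≈⟨ +-assoc 1# ⌜ N ⌝ (p y) ⟨
    ⌜ suc N ⌝ + p y ∎))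

  -- The function is stored beside its affine description because the two may differ below
  -- `threshold`, where `p` can truncate.
  record Affine : Set where
    field
      fun       : Carrier → Carrier
      fun-cong  : ∀ {x y} → x ≈ y → fun x ≈ fun y
      threshold : ℕ
      slope     : ℕ
      offset    : Carrier
      affine    : ∀ x → fun (⌜ threshold ⌝ + x) ≈ slope ⊗ x + offset

    offset⁺ : ℕ → Carrier
    offset⁺ k = slope ⊗ ⌜ k ⌝ + offset

    -- Moving the origin up by `k` shifts `k` steps of the slope into the offset. Two functions are
    -- brought to a common threshold in this way.
    affine⁺ : ∀ k x → fun (⌜ threshold ℕ.+ k ⌝ + x) ≈ slope ⊗ x + offset⁺ k
    affine⁺ k x = begin
      fun (⌜ threshold ℕ.+ k ⌝ + x)             ≈⟨ fun-cong (+-congʳ (×-homo-+ 1# threshold k)) ⟩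
      fun (⌜ threshold ⌝ + ⌜ k ⌝ + x)          ≈⟨ fun-cong (+-assoc _ _ _) ⟩
      fun (⌜ threshold ⌝ + (⌜ k ⌝ + x))        ≈⟨ affine (⌜ k ⌝ + x) ⟩
      slope ⊗ (⌜ k ⌝ + x) + offset             ≈⟨ +-congʳ (×-congʳ slope (+-comm _ _)) ⟩
      slope ⊗ (x + ⌜ k ⌝) + offset             ≈⟨ +-congʳ (×-distrib-+ x ⌜ k ⌝ slope) ⟩
      slope ⊗ x + slope ⊗ ⌜ k ⌝ + offset       ≈⟨ +-assoc _ _ _ ⟩
      slope ⊗ x + offset⁺ k                    ∎

  open Affine

  idᴬ : Affine
  idᴬ = record
    { fun       = λ x → x
    ; fun-cong  = λ x≈y → x≈y
    ; threshold = 0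
    ; slope     = 1
    ; offset    = 0#
    ; affine    = λ x → trans (+-identityˡ x) (sym (trans (+-identityʳ _) (×-homo-1 x)))
    }

  constᴬ : Carrier → Affine
  constᴬ c = record
    { fun       = λ _ → c
    ; fun-cong  = λ _ → refl
    ; threshold = 0
    ; slope     = 0
    ; offset    = c
    ; affine    = λ _ → sym (+-identityˡ c)
    }

  _+ᴬ_ : Affine → Affine → Affine
  f +ᴬ g = record
    { fun       = λ x → fun f x + fun g x
    ; fun-cong  = λ x≈y → +-cong (fun-cong f x≈y) (fun-cong g x≈y)
    ; threshold = threshold f ℕ.+ threshold g
    ; slope     = slope f ℕ.+ slope g
    ; offset    = offset⁺ f (threshold g) + offset⁺ g (threshold f)
    ; affine    = λ x → begin
        fun f (⌜ threshold f ℕ.+ threshold g ⌝ + x) + fun g (⌜ threshold f ℕ.+ threshold g ⌝ + x)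
          ≈⟨ +-congˡ (fun-cong g (+-congʳ (×-congˡ (ℕ.+-comm (threshold f) (threshold g))))) ⟩
        fun f (⌜ threshold f ℕ.+ threshold g ⌝ + x) + fun g (⌜ threshold g ℕ.+ threshold f ⌝ + x)
          ≈⟨ +-cong (affine⁺ f (threshold g) x) (affine⁺ g (threshold f) x) ⟩
        (slope f ⊗ x + offset⁺ f (threshold g)) + (slope g ⊗ x + offset⁺ g (threshold f))
          ≈⟨ interchange _ _ _ _ ⟩
        (slope f ⊗ x + slope g ⊗ x) + (offset⁺ f (threshold g) + offset⁺ g (threshold f))
          ≈⟨ +-congʳ (×-homo-+ x (slope f) (slope g)) ⟨
        (slope f ℕ.+ slope g) ⊗ x + (offset⁺ f (threshold g) + offset⁺ g (threshold f)) ∎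
    }

  sᴬ : Affine → Affine
  sᴬ f = constᴬ 1# +ᴬ f

  -- A nonconstant affine function is nonzero past its threshold, so truncation plays no role there.
  p-affine : ∀ f → ∃[ N ] ∃[ α ] ∃[ β ] (∀ x → p (fun f (⌜ N ⌝ + x)) ≈ α ⊗ x + β)
  p-affine f with slope f in slope≡
  ... | zero  = threshold f , 0 , p (offset f) , λ x → begin
    p (fun f (⌜ threshold f ⌝ + x)) ≈⟨ p-cong (affine f x) ⟩
    p (slope f ⊗ x + offset f)      ≈⟨ p-cong (+-congʳ (×-congˡ slope≡)) ⟩
    p (0# + offset f)               ≈⟨ p-cong (+-identityˡ _) ⟩
    p (offset f)                    ≈⟨ +-identityˡ _ ⟨
    0# + p (offset f)               ∎
  -- At the threshold itself the offset may be zero. One step further it has gained a positive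
  -- slope, hence a summand `1#`.
  ... | suc α = threshold f ℕ.+ 1 , slope f , p (offset⁺ f 1) ,
    λ x → trans (p-cong (affine⁺ f 1 x)) (p-+ (slope f ⊗ x) offset⁺≉0)
    where
    offset⁺≉0 : ¬ offset⁺ f 1 ≈ 0#
    offset⁺≉0 eq = 0≉s _ (begin
      0#                                ≈⟨ eq ⟨
      slope f ⊗ ⌜ 1 ⌝ + offset f        ≈⟨ +-congʳ (×-congˡ slope≡) ⟩
      ⌜ 1 ⌝ + α ⊗ ⌜ 1 ⌝ + offset f      ≈⟨ +-congʳ (+-congʳ (+-identityʳ 1#)) ⟩
      1# + α ⊗ ⌜ 1 ⌝ + offset f         ≈⟨ +-assoc _ _ _ ⟩
      s (α ⊗ ⌜ 1 ⌝ + offset f)          ∎)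

  pᴬ : Affine → Affine
  pᴬ f = let N , α , β , eq = p-affine f in record
    { fun       = p ∘ fun f
    ; fun-cong  = p-cong ∘ fun-cong f
    ; threshold = N
    ; slope     = α
    ; offset    = β
    ; affine    = eq
    }

  -- Where an equation between two such functions changes its truth value.

  module _ (f g : Affine) where
    private
      N α α′ : ℕ
      N  = threshold f ℕ.+ threshold g
      α  = slope f
      α′ = slope g

      β β′ : Carrier
      β  = offset⁺ f (threshold g)
      β′ = offset⁺ g (threshold f)

      E : Carrier → Set
      E x = fun f x ≈ fun g x

      E? : Unary.Decidable E
      E? x = fun f x ≟ fun g x

      E-resp : ∀ {x y} → x ≈ y → E x → E y
      E-resp x≈y Ex = trans (fun-cong f (sym x≈y)) (trans Ex (fun-cong g x≈y))

      f-affine : ∀ x → fun f (⌜ N ⌝ + x) ≈ α ⊗ x + β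
      f-affine = affine⁺ f (threshold g)

      g-affine : ∀ x → fun g (⌜ N ⌝ + x) ≈ α′ ⊗ x + β′
      g-affine x = trans (fun-cong g (+-congʳ (×-congˡ (ℕ.+-comm (threshold f) (threshold g)))))
                         (affine⁺ g (threshold f) x)

      E⇒equation : ∀ {x} → E (⌜ N ⌝ + x) → α ⊗ x + β ≈ α′ ⊗ x + β′
      E⇒equation {x} Ex = trans (sym (f-affine x)) (trans Ex (g-affine x))

      equation⇒E : ∀ {x} → α ⊗ x + β ≈ α′ ⊗ x + β′ → E (⌜ N ⌝ + x)
      equation⇒E {x} eq = trans (f-affine x) (trans eq (sym (g-affine x)))

      -- The step from `x` to `s x` adds `⌜ α ⌝` on the left and `⌜ α′ ⌝` on the right, so the
      -- slopes agree, and then the offsets agree by cancellation. The two points have to be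
      -- successive: with torsion, an equation with different slopes can have several solutions.
      two-solutions⇒identity : ∀ {x} → E (⌜ N ⌝ + x) → E (⌜ N ⌝ + s x) → ∀ y → E (⌜ N ⌝ + y)
      two-solutions⇒identity {x} Ex Esx y = equation⇒E (begin
        α ⊗ y + β    ≈⟨ +-congˡ β≈β′ ⟩
        α ⊗ y + β′   ≈⟨ +-congʳ (×-congˡ α≡α′) ⟩
        α′ ⊗ y + β′  ∎)
        where
        eq : α ⊗ x + β ≈ α′ ⊗ x + β′
        eq = E⇒equation Ex

        α≡α′ : α ≡ α′
        α≡α′ = ⌜⌝-injective α α′ (+-cancelʳ (α ⊗ x + β) (begin
          ⌜ α ⌝ + (α ⊗ x + β)     ≈⟨ +-assoc _ _ _ ⟨
          ⌜ α ⌝ + α ⊗ x + β       ≈⟨ +-congʳ (⊗-s α x) ⟨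
          α ⊗ s x + β             ≈⟨ E⇒equation Esx ⟩
          α′ ⊗ s x + β′           ≈⟨ +-congʳ (⊗-s α′ x) ⟩
          ⌜ α′ ⌝ + α′ ⊗ x + β′    ≈⟨ +-assoc _ _ _ ⟩
          ⌜ α′ ⌝ + (α′ ⊗ x + β′)  ≈⟨ +-congˡ eq ⟨
          ⌜ α′ ⌝ + (α ⊗ x + β)    ∎))

        β≈β′ : β ≈ β′
        β≈β′ = +-cancelˡ (α ⊗ x) (trans eq (+-congʳ (×-congˡ (≡.sym α≡α′))))

      numerals : List Carrier
      numerals = map ⌜_⌝ (upTo (suc N))

      -- Whichever solution `solve?` returns is good enough: if the equation fails at `⌜ N ⌝`, no
      -- two successive points beyond `⌜ N ⌝` satisfy it.
      solution : List Carrier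
      solution with solve? α β α′ β′
      ... | yes (x , _) = p (⌜ N ⌝ + x) ∷ []
      ... | no _        = []

      numeral∈ : ∀ {j} → j < suc N → ⌜ j ⌝ ∈ numerals ++ solution
      numeral∈ j≤N = ∈-++⁺ˡ (∈-map⁺ ⌜_⌝ (∈-upTo⁺ j≤N))

    candidates : List Carrier
    candidates = numerals ++ solution

    candidate-leaving : E 0# → ∀ {a} → ¬ E a → ∃[ c ] c ∈ candidates × E c × ¬ E (s c)
    -- The search runs to `suc N` so that, if it finds no change, `⌜ N ⌝` and its successor are two
    -- successive solutions. The equation is then an identity from `⌜ N ⌝` on, which leaves no room
    -- for `a`.
    candidate-leaving E0 {a} ¬Ea with first-change (E? ∘ ⌜_⌝) E0 (suc N)
    ... | inj₂ (j , j≤N , Ej , ¬Esj) = ⌜ j ⌝ , numeral∈ j≤N , Ej , ¬Esj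
    ... | inj₁ E≤ with below-or-above N a
    ...   | inj₁ (j , j<N , a≈j) =
            contradiction (E-resp (sym a≈j) (E≤ j (ℕ.m≤n⇒m≤1+n (ℕ.<⇒≤ j<N)))) ¬Ea
    ...   | inj₂ (x , a≈N+x) =
            contradiction (E-resp (sym a≈N+x) (two-solutions⇒identity EN EsN x)) ¬Ea
      where
      EN : E (⌜ N ⌝ + 0#)
      EN = E-resp (sym (+-identityʳ _)) (E≤ N (ℕ.m≤n⇒m≤1+n ℕ.≤-refl))

      EsN : E (⌜ N ⌝ + s 0#)
      EsN = E-resp (sym (trans (+-s _ _) (+-congˡ (+-identityʳ _)))) (E≤ (suc N) ℕ.≤-refl)

    -- If all numerals up to `N` fail, then `a` lies beyond them, so `solve?` succeeds, possibly
    -- with a solution other than `a`. The predecessor of that solution cannot be a solution too,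
    -- since the identity would reach down to `⌜ N ⌝`.
    candidate-entering : ¬ E 0# → ∀ {a} → E a → ∃[ c ] c ∈ candidates × ¬ E c × E (s c)
    candidate-entering ¬E0 {a} Ea with first-change (λ j → ¬? (E? ⌜ j ⌝)) ¬E0 N
    ... | inj₂ (j , j<N , ¬Ej , ¬¬Esj) =
          ⌜ j ⌝ , numeral∈ (ℕ.m<n⇒m<1+n j<N) , ¬Ej , decidable-stable (E? ⌜ suc j ⌝) ¬¬Esj
    ... | inj₁ ¬E≤ = beyond
      where
      beyond : ∃[ c ] c ∈ numerals ++ solution × ¬ E c × E (s c)
      beyond with below-or-above N a | solve? α β α′ β′
      ... | inj₁ (j , j<N , a≈j) | _            = contradiction (E-resp a≈j Ea) (¬E≤ j (ℕ.<⇒≤ j<N))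
      ... | inj₂ (y , a≈N+y)     | no unsolvable =
            contradiction (y , E⇒equation (E-resp a≈N+y Ea)) unsolvable
      ... | inj₂ (y , a≈N+y)     | yes (x , eq)  =
            p (⌜ N ⌝ + x) , ∈-++⁺ʳ numerals (here ≡.refl) , ¬Ec , E-resp (s-p N+x≉0) Ex
        where
        Ex : E (⌜ N ⌝ + x)
        Ex = equation⇒E eq

        N+x≉0 : ¬ ⌜ N ⌝ + x ≈ 0#
        N+x≉0 N+x≈0 = ¬E0 (E-resp N+x≈0 Ex)

        x≉0 : ¬ x ≈ 0#
        x≉0 x≈0 = ¬E≤ N ℕ.≤-refl (E-resp (trans (+-congˡ x≈0) (+-identityʳ _)) Ex)

        ¬Ec : ¬ E (p (⌜ N ⌝ + x))
        ¬Ec Ec = ¬E≤ N ℕ.≤-refl (E-resp (+-identityʳ _)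
          (two-solutions⇒identity (E-resp (p-+ ⌜ N ⌝ x≉0) Ec) (E-resp (+-congˡ (s-p x≉0)) Ex) 0#))

private
  module ℤ+ = AbelianGroupProperties ℤ.+-0-abelianGroup
  module ℕ* = CommutativeSemigroupProperties ℕ.*-commutativeSemigroup

-- The nonstandard model with torsion.

module NonstandardModel (m : ℕ) (1<m : 1 < m) where
  private instance
    m≢0 : NonZero m
    m≢0 = ℕ.>-nonZero (ℕ.<⇒≤ 1<m)

  -- Height is measured in units of which `m` make one successor. Degree 0 admits whole successors
  -- only; positive degrees admit all fractions with denominator `m` and all residue classes.
  Admissible : ℕ → ℤ → ℤ → Set
  Admissible zero    z r = ∃[ j ] z ≡ + (j ℕ.* m) × + m ℤ.∣ r
  Admissible (suc k) z r = ⊤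

  record Element : Set where
    constructor element
    field
      degree     : ℕ
      height     : ℤ
      residue    : ℤ
      admissible : Admissible degree height residue
  open Element

  infix 4 _≈_
  -- Residues are integers standing for their classes; comparing them modulo `m` yields the factor
  -- ℤ/m without normal forms.
  record _≈_ (x y : Element) : Set where
    constructor ⟨_,_,_⟩
    field
      degree≡  : degree x ≡ degree y
      height≡  : height x ≡ height y
      residue≡ : + m ℤ.∣ residue x ℤ.- residue y

  ∣-≡ : ∀ {i j} → i ≡ j → + m ℤ.∣ i → + m ℤ.∣ j
  ∣-≡ = ≡.subst (+ m ℤ.∣_)

  ∣-self : ∀ r → + m ℤ.∣ r ℤ.- r
  ∣-self r = divides (+ 0) (ℤ.+-inverseʳ r)

  ≡⇒∣ : ∀ {i j} → i ≡ j → + m ℤ.∣ i ℤ.- j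
  ≡⇒∣ {i} ≡.refl = ∣-self i

  ≈-refl : ∀ {x} → x ≈ x
  ≈-refl {x} = ⟨ ≡.refl , ≡.refl , ∣-self (residue x) ⟩

  ≈-sym : ∀ {x y} → x ≈ y → y ≈ x
  ≈-sym {x} {y} ⟨ d , h , r ⟩ =
    ⟨ ≡.sym d , ≡.sym h , ∣-≡ (lemma (residue x) (residue y)) (ℤ.∣m⇒∣-m r) ⟩
    where
    lemma : ∀ a b → ℤ.- (a ℤ.- b) ≡ b ℤ.- a
    lemma = solve-∀

  ≈-trans : ∀ {x y z} → x ≈ y → y ≈ z → x ≈ z
  ≈-trans {x} {y} {z} ⟨ d , h , r ⟩ ⟨ d′ , h′ , r′ ⟩ =
    ⟨ ≡.trans d d′ , ≡.trans h h′ ,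
      ∣-≡ (lemma (residue x) (residue y) (residue z)) (ℤ.∣m∣n⇒∣m+n r r′) ⟩
    where
    lemma : ∀ a b c → (a ℤ.- b) ℤ.+ (b ℤ.- c) ≡ a ℤ.- c
    lemma = solve-∀

  infixl 6 _+_
  _+_ : Element → Element → Element
  x + y = element (degree x ℕ.+ degree y) (height x ℤ.+ height y) (residue x ℤ.+ residue y)
                  (+-admissible (degree x) (degree y) (admissible x) (admissible y))
    where
    +-admissible : ∀ k k′ {z z′ r r′} → Admissible k z r → Admissible k′ z′ r′ →
                   Admissible (k ℕ.+ k′) (z ℤ.+ z′) (r ℤ.+ r′)
    +-admissible (suc k) k′       _ _ = tt
    +-admissible zero    (suc k′) _ _ = tt
    +-admissible zero    zero (j , z≡ , m∣r) (j′ , z′≡ , m∣r′) =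
      j ℕ.+ j′ ,
      ≡.trans (≡.cong₂ ℤ._+_ z≡ z′≡) (≡.cong +_ (≡.sym (ℕ.*-distribʳ-+ m j j′))) ,
      ℤ.∣m∣n⇒∣m+n m∣r m∣r′

  0# 1# : Element
  0# = element 0 (+ 0) (+ 0) (0 , ≡.refl , divides (+ 0) ≡.refl)
  1# = element 0 (+ m) (+ 0) (1 , ≡.cong +_ (≡.sym (ℕ.+-identityʳ m)) , divides (+ 0) ≡.refl)

  +-cong : ∀ {x y u v} → x ≈ y → u ≈ v → x + u ≈ y + v
  +-cong {x} {y} {u} {v} ⟨ d , h , r ⟩ ⟨ d′ , h′ , r′ ⟩ =
    ⟨ ≡.cong₂ ℕ._+_ d d′ , ≡.cong₂ ℤ._+_ h h′ ,
      ∣-≡ (lemma (residue x) (residue y) (residue u) (residue v)) (ℤ.∣m∣n⇒∣m+n r r′) ⟩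
    where
    lemma : ∀ a b c d → (a ℤ.- b) ℤ.+ (c ℤ.- d) ≡ (a ℤ.+ c) ℤ.- (b ℤ.+ d)
    lemma = solve-∀

  +-cancelˡ : ∀ x {y z} → x + y ≈ x + z → y ≈ z
  +-cancelˡ x {y} {z} ⟨ d , h , r ⟩ =
    ⟨ ℕ.+-cancelˡ-≡ (degree x) _ _ d , ℤ+.∙-cancelˡ (height x) _ _ h ,
      ∣-≡ (lemma (residue x) (residue y) (residue z)) r ⟩
    where
    lemma : ∀ a b c → (a ℤ.+ b) ℤ.- (a ℤ.+ c) ≡ b ℤ.- c
    lemma = solve-∀

  +-commutativeMonoid : CommutativeMonoid 0ℓ 0ℓ
  +-commutativeMonoid = record
    { Carrier = Element
    ; _≈_     = _≈_
    ; _∙_     = _+_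
    ; ε       = 0#
    ; isCommutativeMonoid = record
      { isMonoid = record
        { isSemigroup = record
          { isMagma = record
            { isEquivalence = record { refl = ≈-refl ; sym = ≈-sym ; trans = ≈-trans }
            ; ∙-cong        = +-cong
            }
          ; assoc = λ x y z → ⟨ ℕ.+-assoc (degree x) _ _ , ℤ.+-assoc (height x) _ _ ,
                                ≡⇒∣ (ℤ.+-assoc (residue x) _ _) ⟩
          }
        ; identity = (λ x → ⟨ ≡.refl , ℤ.+-identityˡ _ , ≡⇒∣ (ℤ.+-identityˡ (residue x)) ⟩)
                   , (λ x → ⟨ ℕ.+-identityʳ _ , ℤ.+-identityʳ _ , ≡⇒∣ (ℤ.+-identityʳ (residue x)) ⟩)
        }
      ; comm = λ x y → ⟨ ℕ.+-comm (degree x) _ , ℤ.+-comm (height x) _ ,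
                         ≡⇒∣ (ℤ.+-comm (residue x) (residue y)) ⟩
      }
    }

  open Mult +-commutativeMonoid using (×-homo-+) renaming (_×_ to _⊗_)

  _≟_ : Decidable _≈_
  x ≟ y = map′ (λ (d , h , r) → ⟨ d , h , r ⟩) (λ (⟨ d , h , r ⟩) → d , h , r)
    (degree x ℕ.≟ degree y ×-dec height x ℤ.≟ height y ×-dec + m ℤ.∣? (residue x ℤ.- residue y))

  -- A positive degree has no least height, so truncation is confined to the numeral 0.
  p : Element → Element
  p (element zero    z r (zero  , _  , _))   = 0#
  p (element zero    z r (suc j , z≡ , m∣r)) =
    element zero (+ (j ℕ.* m)) r (j , ≡.refl , m∣r)
  p (element (suc k) z r _)                  = element (suc k) (z ℤ.- + m) r tt

  p-0 : ∀ {x} → x ≈ 0# → p x ≈ 0#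
  p-0 {element zero z r (zero  , _  , _)} _ = ≈-refl
  p-0 {element zero z r (suc j , z≡ , _)} ⟨ _ , z≡0 , _ ⟩ =
    contradiction (ℕ.m+n≡0⇒m≡0 m (ℤ.+-injective (≡.trans (≡.sym z≡) z≡0))) (ℕ.≢-nonZero⁻¹ m)

  s-p : ∀ {x} → ¬ x ≈ 0# → x ≈ 1# + p x
  s-p {element zero z r (zero , z≡ , m∣r)} x≉0 =
    contradiction ⟨ ≡.refl , z≡ , ∣-≡ (≡.sym (ℤ.+-identityʳ r)) m∣r ⟩ x≉0
  s-p {element zero z r (suc j , z≡ , _)}  _ = ⟨ ≡.refl , z≡ , ≡⇒∣ (≡.sym (ℤ.+-identityˡ r)) ⟩
  s-p {element (suc k) z r _}              _ =
    ⟨ ≡.refl , lemma z (+ m) , ≡⇒∣ (≡.sym (ℤ.+-identityˡ r)) ⟩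
    where
    lemma : ∀ a b → a ≡ b ℤ.+ (a ℤ.- b)
    lemma = solve-∀

  0≉s : ∀ x → ¬ 0# ≈ 1# + x
  0≉s (element zero z r (j , ≡.refl , _)) ⟨ _ , h , _ ⟩ =
    contradiction (ℕ.m+n≡0⇒m≡0 m (≡.sym (ℤ.+-injective h))) (ℕ.≢-nonZero⁻¹ m)

  -- `p` inspects the admissibility evidence, which `_≈_` does not compare. Away from 0, however,
  -- `p x` is determined up to `_≈_` by `x ≈ 1# + p x` and cancellation.
  p-cong : ∀ {x y} → x ≈ y → p x ≈ p y
  p-cong {x} {y} x≈y with x ≟ 0#
  ... | yes x≈0 = ≈-trans (p-0 x≈0) (≈-sym (p-0 (≈-trans (≈-sym x≈y) x≈0)))
  ... | no  x≉0 = +-cancelˡ 1#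
    (≈-trans (≈-sym (s-p x≉0)) (≈-trans x≈y (s-p λ y≈0 → x≉0 (≈-trans x≈y y≈0))))

  p-s : ∀ x → p (1# + x) ≈ x
  p-s x = +-cancelˡ 1# (≈-sym (s-p λ eq → 0≉s x (≈-sym eq)))

  -- Deciding linear equations in the model.

  degree-⊗ : ∀ n x → degree (n ⊗ x) ≡ n ℕ.* degree x
  degree-⊗ zero    x = ≡.refl
  degree-⊗ (suc n) x = ≡.cong (degree x ℕ.+_) (degree-⊗ n x)

  height-⊗ : ∀ n x → height (n ⊗ x) ≡ + n ℤ.* height x
  height-⊗ zero    x = ≡.refl
  height-⊗ (suc n) x =
    ≡.trans (≡.cong (λ z → height x ℤ.+ z) (height-⊗ n x)) (≡.sym (ℤ.suc-* (+ n) (height x)))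

  residue-⊗ : ∀ n x → residue (n ⊗ x) ≡ + n ℤ.* residue x
  residue-⊗ zero    x = ≡.refl
  residue-⊗ (suc n) x =
    ≡.trans (≡.cong (λ r → residue x ℤ.+ r) (residue-⊗ n x)) (≡.sym (ℤ.suc-* (+ n) (residue x)))

  module _ (d : ℕ) .{{_ : NonZero d}} where

    positive-quotient? : ∀ k K → Dec (∃[ j ] d ℕ.* suc j ℕ.+ k ≡ K)
    positive-quotient? k K =
      map′ (λ (j , _ , eq) → j , eq)
           -- As `d` is nonzero, `j` lies below `d ℕ.* suc j` and hence below `K`, which bounds the
           -- search.
           (λ (j , eq) → j , ≡.subst (j <_) eq (ℕ.m≤n⇒m≤n+o k (ℕ.m≤n*m (suc j) d)) , eq)
           (ℕ.anyUpTo? (λ j → d ℕ.* suc j ℕ.+ k ℕ.≟ K) K)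

    integer-quotient? : ∀ i → Dec (∃[ z ] + d ℤ.* z ≡ i)
    integer-quotient? i =
      map′ (λ (divides q eq) → q , ≡.trans (ℤ.*-comm (+ d) q) (≡.sym eq))
           (λ (z , eq) → divides z (≡.trans (≡.sym eq) (ℤ.*-comm (+ d) z)))
           (+ d ℤ.∣? i)

    natural-quotient? : ∀ i → Dec (∃[ j ] + d ℤ.* + (j ℕ.* m) ≡ i)
    natural-quotient? (-[1+ i ]) =
      no λ (j , eq) → contradiction (≡.trans (ℤ.pos-* d (j ℕ.* m)) eq) λ ()
    natural-quotient? (+ i) =
      map′ (λ (ℕ.divides j i≡) → j , ≡.trans (product j) (≡.cong +_ (≡.sym i≡)))
           (λ (j , eq) → ℕ.divides j (ℤ.+-injective (≡.trans (≡.sym eq) (product j))))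
           (d ℕ.* m ℕ.∣? i)
      where
      product : ∀ j → + d ℤ.* + (j ℕ.* m) ≡ + (j ℕ.* (d ℕ.* m))
      product j = ≡.trans (≡.sym (ℤ.pos-* d (j ℕ.* m))) (≡.cong +_ (ℕ*.x∙yz≈y∙xz d j m))

    -- Solvability depends on `r` modulo `m` only, so the finitely many remainders can be tried.
    residue-quotient? : ∀ i → Dec (∃[ r ] + m ℤ.∣ + d ℤ.* r ℤ.- i)
    residue-quotient? i =
      map′ (λ (r , m∣) → + toℕ r , m∣) (λ (r , m∣) → reduce r m∣)
           (any? {n = m} (λ r → + m ℤ.∣? (+ d ℤ.* + toℕ r ℤ.- i)))
      where
      lemma : ∀ D r q M i → (D ℤ.* (r ℤ.+ q ℤ.* M) ℤ.- i) ℤ.- D ℤ.* q ℤ.* M ≡ D ℤ.* r ℤ.- i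
      lemma = solve-∀

      reduce : ∀ r → + m ℤ.∣ + d ℤ.* r ℤ.- i → ∃[ r′ ] + m ℤ.∣ + d ℤ.* + toℕ {m} r′ ℤ.- i
      reduce r m∣ = fromℕ< r%m<m , ∣-≡ eq (ℤ.∣m∣n⇒∣m-n m∣ (divides (+ d ℤ.* (r ℤ./ℕ m)) ≡.refl))
        where
        r%m<m = ℤ.n%ℕd<d r m
        eq : (+ d ℤ.* r ℤ.- i) ℤ.- + d ℤ.* (r ℤ./ℕ m) ℤ.* + m ≡ + d ℤ.* + toℕ (fromℕ< r%m<m) ℤ.- i
        eq = ≡.trans (≡.cong (λ r′ → (+ d ℤ.* r′ ℤ.- i) ℤ.- + d ℤ.* (r ℤ./ℕ m) ℤ.* + m)
                             (ℤ.a≡a%ℕn+[a/ℕn]*n r m))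
            (≡.trans (lemma (+ d) (+ (r ℤ.%ℕ m)) (r ℤ./ℕ m) (+ m) i)
                     (≡.cong (λ r′ → + d ℤ.* + r′ ℤ.- i) (≡.sym (toℕ-fromℕ< r%m<m))))

  private
    move : ∀ a b c → a ℤ.+ b ≡ c → a ≡ c ℤ.- b
    move a b c ≡.refl = lemma a b
      where
      lemma : ∀ a b → a ≡ (a ℤ.+ b) ℤ.- b
      lemma = solve-∀

    unmove : ∀ a b c → a ≡ c ℤ.- b → a ℤ.+ b ≡ c
    unmove a b c ≡.refl = lemma b c
      where
      lemma : ∀ b c → (c ℤ.- b) ℤ.+ b ≡ c
      lemma = solve-∀

    regroup : ∀ a b c → (a ℤ.+ b) ℤ.- c ≡ a ℤ.- (c ℤ.- b)
    regroup = solve-∀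

  -- The coordinates of `x` are linked only by `Admissible`. Once the degree of `x` is fixed as zero
  -- or positive, the equation splits into independent conditions on degree, height and residue.
  divide? : ∀ d β β′ → Dec (∃[ x ] d ⊗ x + β ≈ β′)
  divide? zero β β′ =
    map′ (λ eq → 0# , ≈-trans (+-identityˡ β) eq)
         (λ (_ , eq) → ≈-trans (≈-sym (+-identityˡ β)) eq)
         (β ≟ β′)
    where open CommutativeMonoid +-commutativeMonoid using () renaming (identityˡ to +-identityˡ)
  divide? d@(suc _) β β′ = map′ to from (standard? ⊎-dec nonstandard?)
    where
    h = height β′ ℤ.- height β
    r = residue β′ ℤ.- residue β

    Standard Nonstandard : Set
    -- A numeral contributes nothing to the degree and a multiple of `m` to the residue.
    Standard    = degree β ≡ degree β′ × (∃[ j ] + d ℤ.* + (j ℕ.* m) ≡ h) ×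
                  + m ℤ.∣ residue β ℤ.- residue β′
    Nonstandard = (∃[ k ] d ℕ.* suc k ℕ.+ degree β ≡ degree β′) ×
                  (∃[ z ] + d ℤ.* z ≡ h) × (∃[ ρ ] + m ℤ.∣ + d ℤ.* ρ ℤ.- r)

    standard? : Dec Standard
    standard? = degree β ℕ.≟ degree β′ ×-dec natural-quotient? d h ×-dec
                + m ℤ.∣? (residue β ℤ.- residue β′)

    nonstandard? : Dec Nonstandard
    nonstandard? = positive-quotient? d (degree β) (degree β′) ×-dec
                   integer-quotient? d h ×-dec residue-quotient? d r

    solves : ∀ x → d ℕ.* degree x ℕ.+ degree β ≡ degree β′ → + d ℤ.* height x ≡ h →
             + m ℤ.∣ + d ℤ.* residue x ℤ.- r → d ⊗ x + β ≈ β′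
    solves x eqᵈ eqʰ m∣ =
      ⟨ ≡.trans (≡.cong (ℕ._+ degree β) (degree-⊗ d x)) eqᵈ ,
        unmove _ (height β) _ (≡.trans (height-⊗ d x) eqʰ) ,
        ∣-≡ (≡.trans (≡.cong (ℤ._- r) (≡.sym (residue-⊗ d x)))
                     (≡.sym (regroup (residue (d ⊗ x)) (residue β) (residue β′)))) m∣ ⟩

    to : Standard ⊎ Nonstandard → ∃[ x ] d ⊗ x + β ≈ β′
    to (inj₁ (eqᵈ , (j , eqʰ) , m∣)) = x , solves x
      (≡.trans (≡.cong (ℕ._+ degree β) (ℕ.*-zeroʳ d)) eqᵈ) eqʰ (∣-≡ eqʳ m∣)
      where
      x = element 0 (+ (j ℕ.* m)) (+ 0) (j , ≡.refl , divides (+ 0) ≡.refl)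
      lemma : ∀ D a b → a ℤ.- b ≡ D ℤ.* + 0 ℤ.- (b ℤ.- a)
      lemma = solve-∀
      eqʳ = lemma (+ d) (residue β) (residue β′)
    to (inj₂ ((k , eqᵈ) , (z , eqʰ) , (ρ , m∣))) = x , solves x eqᵈ eqʰ m∣
      where x = element (suc k) z ρ tt

    from : ∃[ x ] d ⊗ x + β ≈ β′ → Standard ⊎ Nonstandard
    from (x , ⟨ eqᵈ , eqʰ , eqʳ ⟩) = split x
      (≡.trans (≡.cong (ℕ._+ degree β) (≡.sym (degree-⊗ d x))) eqᵈ)
      (≡.trans (≡.sym (height-⊗ d x)) (move _ (height β) _ eqʰ))
      (∣-≡ (≡.trans (regroup (residue (d ⊗ x)) (residue β) (residue β′))
                    (≡.cong (ℤ._- r) (residue-⊗ d x))) eqʳ)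
      where
      split : ∀ x → d ℕ.* degree x ℕ.+ degree β ≡ degree β′ → + d ℤ.* height x ≡ h →
              + m ℤ.∣ + d ℤ.* residue x ℤ.- r → Standard ⊎ Nonstandard
      split (element (suc k) z ρ _) eqᵈ eqʰ m∣ = inj₂ ((k , eqᵈ) , (z , eqʰ) , (ρ , m∣))
      split (element zero _ ρ (j , ≡.refl , m∣ρ)) eqᵈ eqʰ m∣ =
        inj₁ (≡.trans (≡.cong (ℕ._+ degree β) (≡.sym (ℕ.*-zeroʳ d))) eqᵈ , (j , eqʰ) ,
              ∣-≡ (lemma (+ d ℤ.* ρ) (residue β) (residue β′))
                  (ℤ.∣m∣n⇒∣m-n m∣ (ℤ.∣n⇒∣m*n (+ d) m∣ρ)))
        where
        lemma : ∀ a b c → (a ℤ.- (c ℤ.- b)) ℤ.- a ≡ b ℤ.- c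
        lemma = solve-∀

  subtract-slope : ∀ α d x β → (α ℕ.+ d) ⊗ x + β ≈ α ⊗ x + (d ⊗ x + β)
  subtract-slope α d x β = ≈-trans (+-cong (×-homo-+ x α d) ≈-refl) (+-assoc (α ⊗ x) (d ⊗ x) β)
    where open CommutativeMonoid +-commutativeMonoid using () renaming (assoc to +-assoc)

  -- Cancelling the smaller slope leaves the unknown on one side only; comparing the slopes tells
  -- which side.
  solve? : ∀ α β α′ β′ → Dec (∃[ x ] α ⊗ x + β ≈ α′ ⊗ x + β′)
  solve? α β α′ β′ with ℕ.≤-total α α′
  ... | inj₁ α≤α′ with d , ≡.refl ← ℕ.m≤n⇒∃[o]m+o≡n α≤α′ =
        map′ (λ (x , eq) → x , ≈-trans (+-cong (≈-refl {α ⊗ x}) (≈-sym eq))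
                                   (≈-sym (subtract-slope α d x β′)))
             (λ (x , eq) → x , ≈-sym (+-cancelˡ (α ⊗ x) (≈-trans eq (subtract-slope α d x β′))))
             (divide? d β′ β)
  ... | inj₂ α′≤α with d , ≡.refl ← ℕ.m≤n⇒∃[o]m+o≡n α′≤α =
        map′ (λ (x , eq) → x , ≈-trans (subtract-slope α′ d x β) (+-cong (≈-refl {α′ ⊗ x}) eq))
             (λ (x , eq) → x , +-cancelˡ (α′ ⊗ x) (≈-trans (≈-sym (subtract-slope α′ d x β)) eq))
             (divide? d β β′)

  arithmetic : Arithmetic
  arithmetic = record
    { +-commutativeMonoid = +-commutativeMonoid
    ; 1#        = 1#
    ; p         = p
    ; p-cong    = p-cong
    ; 0≉s       = 0≉s
    ; p-0       = p-0 ≈-refl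
    ; p-s       = p-s
    ; s-p       = s-p
    ; +-cancelˡ = +-cancelˡ
    ; _≟_       = _≟_
    ; solve?    = solve?
    }

  -- Elements that violate cancellation and nondivisibility.

  -- They differ by the class of 1 in ℤ/m, which is nonzero because `1 < m` and is annihilated by
  -- `m`.
  base torsion : Element
  base    = element 1 (+ 0) (+ 0) tt
  torsion = element 1 (+ 0) (+ 1) tt

  -- This is `base` moved up by the fraction n/m of a successor, as `1#` has height `m`.
  shifted : ℕ → Element
  shifted n = element 1 (+ n) (+ 0) tt

  base≉torsion : ¬ base ≈ torsion
  base≉torsion ⟨ _ , _ , m∣-1 ⟩ =
    contradiction (ℕ.∣1⇒≡1 (ℤ.∣⇒∣ᵤ m∣-1)) λ { ≡.refl → contradiction 1<m (ℕ.<-irrefl ≡.refl) }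

  m⊗base≈m⊗torsion : m ⊗ base ≈ m ⊗ torsion
  m⊗base≈m⊗torsion =
    ⟨ ≡.trans (degree-⊗ m base) (≡.sym (degree-⊗ m torsion)) ,
    ≡.trans (height-⊗ m base) (≡.sym (height-⊗ m torsion)) ,
    ∣-≡ (≡.cong₂ ℤ._-_ (≡.sym (residue-⊗ m base)) (≡.sym (residue-⊗ m torsion)))
        (divides (ℤ.- + 1) (lemma (+ m))) ⟩
    where
    lemma : ∀ M → M ℤ.* + 0 ℤ.- M ℤ.* + 1 ≡ (ℤ.- + 1) ℤ.* M
    lemma = solve-∀

  n+m⊗base≈m⊗shifted : ∀ n → n ⊗ 1# + m ⊗ base ≈ m ⊗ shifted n
  n+m⊗base≈m⊗shifted n =
    ⟨ ≡.trans (≡.cong₂ ℕ._+_ (≡.trans (degree-⊗ n 1#) (ℕ.*-zeroʳ n)) (degree-⊗ m base))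
            (≡.sym (degree-⊗ m (shifted n))) ,
    ≡.trans (≡.cong₂ ℤ._+_ (height-⊗ n 1#) (height-⊗ m base))
            (≡.trans (lemma (+ n) (+ m)) (≡.sym (height-⊗ m (shifted n)))) ,
    ≡⇒∣ (≡.trans (≡.cong₂ ℤ._+_ (residue-⊗ n 1#) (residue-⊗ m base))
                 (≡.trans (lemma₀ (+ n) (+ m)) (≡.sym (residue-⊗ m (shifted n))))) ⟩
    where
    lemma : ∀ N M → N ℤ.* M ℤ.+ M ℤ.* + 0 ≡ M ℤ.* N
    lemma = solve-∀
    lemma₀ : ∀ N M → N ℤ.* + 0 ℤ.+ M ℤ.* + 0 ≡ M ℤ.* + 0
    lemma₀ = solve-∀

-- List search and closed Skolem terms.

transport : {A B : Set} → A ≡ B → A → B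
transport ≡.refl a = a

transport⁻ : {A B : Set} → A ≡ B → B → A
transport⁻ ≡.refl b = b

module _ {A : Set} (f : A → Bool) (default : A) where

  first-false : List A → A
  first-false []       = default
  first-false (x ∷ xs) = if f x then first-false xs else x

  first-false-correct : ∀ {x} xs → x ∈ xs → f x ≡ false → f (first-false xs) ≡ false
  first-false-correct (y ∷ xs) x∈ fx with f y in fy
  first-false-correct (y ∷ xs) x∈           fx | false = fy
  first-false-correct (y ∷ xs) (here ≡.refl)  fx | true  with () ← ≡.trans (≡.sym fx) fy
  first-false-correct (y ∷ xs) (there x∈)   fx | true  = first-false-correct xs x∈ fx

module Substitution (𝔏 : Signature) where
  open FirstOrder 𝔏

  private variable
    V W : Set
    n k : ℕ

  -- The hypothesis is pointwise so that it passes under quantifiers, where `lift var` agrees with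
  -- `var` only pointwise.
  substₜ-var  : {τ : V → Term V} → (∀ v → τ v ≡ var v) → ∀ t → substₜ τ t ≡ t
  substₜₛ-var : {τ : V → Term V} → (∀ v → τ v ≡ var v) → (ts : Vec (Term V) k) → substₜₛ τ ts ≡ ts
  substₜ-var τ≡ (var v)    = τ≡ v
  substₜ-var τ≡ (app f ts) = ≡.cong (app f) (substₜₛ-var τ≡ ts)
  substₜₛ-var τ≡ []       = ≡.refl
  substₜₛ-var τ≡ (t ∷ ts) = ≡.cong₂ _∷_ (substₜ-var τ≡ t) (substₜₛ-var τ≡ ts)

  substₐ-var : {τ : V → Term V} → (∀ v → τ v ≡ var v) → ∀ A → substₐ τ A ≡ A
  substₐ-var τ≡ (t ≐ u)    = ≡.cong₂ _≐_ (substₜ-var τ≡ t) (substₜ-var τ≡ u)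
  substₐ-var τ≡ (rel P ts) = ≡.cong (rel P) (substₜₛ-var τ≡ ts)

  lift-var : {τ : Fin n → Term (Fin n)} → (∀ i → τ i ≡ var i) → ∀ i → lift τ i ≡ var i
  lift-var τ≡ zero    = ≡.refl
  lift-var τ≡ (suc i) = ≡.cong weaken (τ≡ i)

  substᶠ-var : {τ : Fin n → Term (Fin n)} → (∀ i → τ i ≡ var i) → ∀ A → substᶠ τ A ≡ A
  substᶠ-var τ≡ (atom A)    = ≡.cong atom (substₐ-var τ≡ A)
  substᶠ-var τ≡ (neg A)     = ≡.cong neg (substᶠ-var τ≡ A)
  substᶠ-var τ≡ (A ∧ B)     = ≡.cong₂ _∧_ (substᶠ-var τ≡ A) (substᶠ-var τ≡ B)
  substᶠ-var τ≡ (A ∨ B)     = ≡.cong₂ _∨_ (substᶠ-var τ≡ A) (substᶠ-var τ≡ B)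
  substᶠ-var τ≡ (quant Q A) = ≡.cong (quant Q) (substᶠ-var (lift-var τ≡) A)

  skolemTerm-closed : ∀ Q (A : Formula 1) → skolemTerm Q A ≡ const (skolem Q A)
  skolemTerm-closed Q A = closed (free (quant Q A))
    where
    -- `free (quant Q A)` does not reduce for a variable `A`. Generalized to an arbitrary `q`, it
    -- can be matched with `[]`, and the renumbering then fixes every variable.
    closed : (q : Subset 0) →
             app (skolem Q (substᶠ (lift (compress q)) A)) (Vec.map var (members q)) ≡
             const (skolem Q A)
    closed [] = ≡.cong (λ B → const (skolem Q B)) (substᶠ-var (lift-var {τ = compress []} λ ()) A)

-- The structure and its Skolem constants.

module Interpretation (𝔏 : Signature) (𝔸 : Arithmetic) (base : Arithmetic.Carrier 𝔸)
                      (witnesses : List (Arithmetic.Carrier 𝔸)) where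
  open FirstOrder 𝔏 hiding (fun)
  open Substitution 𝔏
  open EventuallyAffine 𝔸
  open Affine
  private module 𝔸 = Arithmetic 𝔸
  open 𝔸 using (Carrier; _≈_; 0#; 1#; _⊗_)

  private variable
    V W : Set
    k n : ℕ

  -- 𝔰_{∀xA} denotes the first counterexample to A in a finite list.  On quantified formulas,
  -- holds is false by convention, so that 𝔰_{∀x∀yB} denotes the base point.
  ⟦_⟧ᶠ    : Fun k → Vec Carrier k → Carrier
  ⟦_⟧ᴬ    : Fun k → Vec Affine k → Affine
  ⟦_⟧ₜ    : Term (Fin 1) → Affine
  ⟦_⟧ₜₛ   : Vec (Term (Fin 1)) k → Vec Affine k
  holdsₐ  : Atom (Fin 1) → Carrier → Bool
  holds   : Formula 1 → Carrier → Bool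
  turnsₐ  : Atom (Fin 1) → List Carrier
  turns   : Formula 1 → List Carrier

  ⟦ `0 ⟧ᶠ []                       = 0#
  ⟦ `s ⟧ᶠ (x ∷ [])                 = 𝔸.s x
  ⟦ `p ⟧ᶠ (x ∷ [])                 = 𝔸.p x
  ⟦ `+ ⟧ᶠ (x ∷ y ∷ [])             = x 𝔸.+ y
  -- A constant value for the additional symbols keeps all terms eventually affine.
  ⟦ op _ ⟧ᶠ _                      = 0#
  -- `witnesses` serve the Skolem constants of `𝒳` and `𝒴`, `turns A` those of the induction rule.
  -- Skolem symbols inside `A` are evaluated by `holds` and `turns`, which is well-founded because
  -- `A` is a component of the symbol.
  ⟦ skolem {zero} all A ⟧ᶠ _       = first-false (holds A) base (base ∷ witnesses ++ turns A)
  ⟦ skolem {zero} ex A ⟧ᶠ _        = 0#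
  ⟦ skolem {suc _} _ _ ⟧ᶠ _        = 0#

  ⟦ `0 ⟧ᴬ []                       = constᴬ 0#
  ⟦ `s ⟧ᴬ (f ∷ [])                 = sᴬ f
  ⟦ `p ⟧ᴬ (f ∷ [])                 = pᴬ f
  ⟦ `+ ⟧ᴬ (f ∷ g ∷ [])             = f +ᴬ g
  ⟦ op _ ⟧ᴬ _                      = constᴬ 0#
  ⟦ skolem {zero} Q A ⟧ᴬ _         = constᴬ (⟦ skolem Q A ⟧ᶠ [])
  ⟦ skolem {suc _} _ _ ⟧ᴬ _        = constᴬ 0#

  ⟦ var _ ⟧ₜ    = idᴬ
  ⟦ app f ts ⟧ₜ = ⟦ f ⟧ᴬ ⟦ ts ⟧ₜₛ
  ⟦ [] ⟧ₜₛ     = []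
  ⟦ t ∷ ts ⟧ₜₛ = ⟦ t ⟧ₜ ∷ ⟦ ts ⟧ₜₛ

  holdsₐ (t ≐ u)   x = does (fun ⟦ t ⟧ₜ x 𝔸.≟ fun ⟦ u ⟧ₜ x)
  holdsₐ (rel _ _) x = true

  holds (atom A)    x = holdsₐ A x
  holds (neg A)     x = not (holds A x)
  holds (A ∧ B)     x = holds A x Bool.∧ holds B x
  holds (A ∨ B)     x = holds A x Bool.∨ holds B x
  holds (quant _ _) x = false

  turnsₐ (t ≐ u)   = candidates ⟦ t ⟧ₜ ⟦ u ⟧ₜ
  turnsₐ (rel _ _) = []

  turns (atom A)    = turnsₐ A
  turns (neg A)     = turns A
  turns (A ∧ B)     = turns A ++ turns B
  turns (A ∨ B)     = turns A ++ turns B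
  turns (quant _ _) = []

  ⟦⟧ᶠ-cong : (f : Fun k) {xs ys : Vec Carrier k} → Pointwise _≈_ xs ys → ⟦ f ⟧ᶠ xs ≈ ⟦ f ⟧ᶠ ys
  ⟦⟧ᶠ-cong `0 []                      = 𝔸.refl
  ⟦⟧ᶠ-cong `s (x≈y ∷ [])              = 𝔸.+-congˡ x≈y
  ⟦⟧ᶠ-cong `p (x≈y ∷ [])              = 𝔸.p-cong x≈y
  ⟦⟧ᶠ-cong `+ (x≈y ∷ u≈v ∷ [])        = 𝔸.+-cong x≈y u≈v
  ⟦⟧ᶠ-cong (op _) _                   = 𝔸.refl
  ⟦⟧ᶠ-cong (skolem {zero} all A) _    = 𝔸.refl
  ⟦⟧ᶠ-cong (skolem {zero} ex A) _     = 𝔸.refl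
  ⟦⟧ᶠ-cong (skolem {suc _} _ _) _     = 𝔸.refl

  𝔐 : Structure
  𝔐 = record
    { Carrier       = Carrier
    ; _≈_           = _≈_
    ; isEquivalence = 𝔸.isEquivalence
    ; ⟦_⟧           = ⟦_⟧ᶠ
    ; ⟦⟧-cong       = ⟦⟧ᶠ-cong
    ; ⟦_⟧ᴾ          = λ _ _ → ⊤
    ; ⟦⟧ᴾ-resp      = λ _ _ _ → tt
    }

  open Structure 𝔐 using (value; values; Trueₐ; Trueₗ)

  value-subst : {ρ : W → Carrier} {τ : V → Term W} {ρ′ : V → Carrier} →
                (∀ v → value ρ (τ v) ≡ ρ′ v) → ∀ t → value ρ (substₜ τ t) ≡ value ρ′ t
  values-subst : {ρ : W → Carrier} {τ : V → Term W} {ρ′ : V → Carrier} →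
                 (∀ v → value ρ (τ v) ≡ ρ′ v) → (ts : Vec (Term V) k) →
                 values ρ (substₜₛ τ ts) ≡ values ρ′ ts
  value-subst eq (var v)    = eq v
  value-subst eq (app f ts) = ≡.cong ⟦ f ⟧ᶠ (values-subst eq ts)
  values-subst eq []       = ≡.refl
  values-subst eq (t ∷ ts) = ≡.cong₂ _∷_ (value-subst eq t) (values-subst eq ts)

  Trueₐ-subst : {ρ : W → Carrier} {τ : V → Term W} {ρ′ : V → Carrier} →
                (∀ v → value ρ (τ v) ≡ ρ′ v) → ∀ A → Trueₐ ρ (substₐ τ A) ≡ Trueₐ ρ′ A
  Trueₐ-subst eq (t ≐ u)   = ≡.cong₂ _≈_ (value-subst eq t) (value-subst eq u)
  Trueₐ-subst eq (rel _ _) = ≡.refl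

  Trueₐ? : (ρ : V → Carrier) → ∀ A → Dec (Trueₐ ρ A)
  Trueₐ? ρ (t ≐ u)   = value ρ t 𝔸.≟ value ρ u
  Trueₐ? ρ (rel _ _) = yes tt

  -- The affine reading of terms precedes the structure, since the Skolem constants are chosen by
  -- means of it. This is the agreement of the two readings.
  value-affine  : ∀ x t → fun ⟦ t ⟧ₜ x ≡ value (λ _ → x) t
  values-affine : ∀ x (ts : Vec (Term (Fin 1)) k) →
                  Vec.map (λ f → fun f x) ⟦ ts ⟧ₜₛ ≡ values (λ _ → x) ts
  value-affine x (var _)    = ≡.refl
  value-affine x (app f ts) = ≡.trans (pointwise f ⟦ ts ⟧ₜₛ) (≡.cong ⟦ f ⟧ᶠ (values-affine x ts))
    where
    pointwise : (f : Fun k) (fs : Vec Affine k) →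
                fun (⟦ f ⟧ᴬ fs) x ≡ ⟦ f ⟧ᶠ (Vec.map (λ f → fun f x) fs)
    pointwise `0 []                   = ≡.refl
    pointwise `s (f ∷ [])             = ≡.refl
    pointwise `p (f ∷ [])             = ≡.refl
    pointwise `+ (f ∷ g ∷ [])         = ≡.refl
    pointwise (op _) _                = ≡.refl
    pointwise (skolem {zero} all A) _ = ≡.refl
    pointwise (skolem {zero} ex A) _  = ≡.refl
    pointwise (skolem {suc _} _ _) _  = ≡.refl
  values-affine x []       = ≡.refl
  values-affine x (t ∷ ts) = ≡.cong₂ _∷_ (value-affine x t) (values-affine x ts)

  ≈-affine : ∀ x t u → (fun ⟦ t ⟧ₜ x ≈ fun ⟦ u ⟧ₜ x) ≡ Trueₐ (λ _ → x) (t ≐ u)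
  ≈-affine x t u = ≡.cong₂ _≈_ (value-affine x t) (value-affine x u)

  holdsₐ-reflects : ∀ A x → Reflects (Trueₐ (λ _ → x) A) (holdsₐ A x)
  holdsₐ-reflects (t ≐ u) x =
    ≡.subst (λ T → Reflects T (holdsₐ (t ≐ u) x)) (≈-affine x t u)
            (proof (fun ⟦ t ⟧ₜ x 𝔸.≟ fun ⟦ u ⟧ₜ x))
  holdsₐ-reflects (rel _ _) x = ofʸ tt

  -- Restricted to literals, since `holds` is a mere convention on quantified formulas.
  holds-reflects : ∀ l x → Reflects (Trueₗ (λ _ → x) l) (holds (literal l) x)
  holds-reflects (pos A) x = holdsₐ-reflects A x
  holds-reflects (neg A) x = ¬-reflects (holdsₐ-reflects A x)

  ⇒-false : ∀ l l′ {x} → Trueₗ (λ _ → x) l → ¬ Trueₗ (λ _ → x) l′ →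
            holds (literal l ⇒ literal l′) x ≡ false
  ⇒-false l l′ {x} tl fl′
    with holds (literal l) x | holds-reflects l x | holds (literal l′) x | holds-reflects l′ x
  ... | true  | _        | false | _        = ≡.refl
  ... | true  | _        | true  | ofʸ tl′  = contradiction tl′ fl′
  ... | false | ofⁿ fl   | _     | _        = contradiction tl fl

  ⇒-false⁻¹ : ∀ l l′ {x} → holds (literal l ⇒ literal l′) x ≡ false →
              Trueₗ (λ _ → x) l × ¬ Trueₗ (λ _ → x) l′
  ⇒-false⁻¹ l l′ {x} eq
    with holds (literal l) x | holds-reflects l x | holds (literal l′) x | holds-reflects l′ x
  ... | true  | ofʸ tl | false | ofⁿ fl′ = tl , fl′
  ... | true  | _      | true  | _       with () ← eq
  ... | false | _      | _     | _       with () ← eq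

  turnsₐ-leaving : ∀ A → let T = λ x → Trueₐ (λ _ → x) A in
                   T 0# → ∀ {a} → ¬ T a → ∃[ c ] c ∈ turnsₐ A × T c × ¬ T (𝔸.s c)
  turnsₐ-leaving (rel _ _) T0 ¬Ta = contradiction tt ¬Ta
  turnsₐ-leaving (t ≐ u) T0 {a} ¬Ta =
    let c , c∈ , Ec , ¬Esc = candidate-leaving ⟦ t ⟧ₜ ⟦ u ⟧ₜ (to 0# T0) (¬Ta ∘ from a)
    in  c , c∈ , from c Ec , ¬Esc ∘ to (𝔸.s c)
    where
    from = λ x → transport (≈-affine x t u)
    to   = λ x → transport⁻ (≈-affine x t u)

  turnsₐ-entering : ∀ A → let T = λ x → Trueₐ (λ _ → x) A in
                    ¬ T 0# → ∀ {a} → T a → ∃[ c ] c ∈ turnsₐ A × ¬ T c × T (𝔸.s c)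
  turnsₐ-entering (rel _ _) ¬T0 Ta = contradiction tt ¬T0
  turnsₐ-entering (t ≐ u) ¬T0 {a} Ta =
    let c , c∈ , ¬Ec , Esc = candidate-entering ⟦ t ⟧ₜ ⟦ u ⟧ₜ (¬T0 ∘ from 0#) (to a Ta)
    in  c , c∈ , ¬Ec ∘ to c , from (𝔸.s c) Esc
    where
    from = λ x → transport (≈-affine x t u)
    to   = λ x → transport⁻ (≈-affine x t u)

  ⟦skolem⟧ : Formula 1 → Carrier
  ⟦skolem⟧ A = ⟦ skolem all A ⟧ᶠ []

  skolem-falsifies : ∀ A {c} → c ∈ base ∷ witnesses ++ turns A →
                     holds A c ≡ false → holds A (⟦skolem⟧ A) ≡ false
  skolem-falsifies A = first-false-correct (holds A) base (base ∷ witnesses ++ turns A)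

  value-skolemTerm : (ρ : Fin 0 → Carrier) (A : Formula 1) → value ρ (skolemTerm all A) ≡ ⟦skolem⟧ A
  value-skolemTerm ρ A = ≡.cong (value ρ) (skolemTerm-closed all A)

  Trueₗ-subst : {ρ : W → Carrier} {τ : V → Term W} {ρ′ : V → Carrier} →
                (∀ v → value ρ (τ v) ≡ ρ′ v) → ∀ l → Trueₗ ρ (substₗ τ l) ≡ Trueₗ ρ′ l
  Trueₗ-subst eq (pos A) = Trueₐ-subst eq A
  Trueₗ-subst eq (neg A) = ≡.cong ¬_ (Trueₐ-subst eq A)

  none : Fin 0 → Carrier
  none ()

  pair : Carrier → Carrier → Fin 2 → Carrier
  pair x y zero       = x
  pair x y (suc zero) = y

  value-pair : (ρ : V → Carrier) {t u : Term V} {x y : Carrier} → value ρ t ≡ x → value ρ u ≡ y →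
               ∀ i → value ρ ((t ▸ u ▸ λ ()) i) ≡ pair x y i
  value-pair ρ t≡ u≡ zero       = t≡
  value-pair ρ t≡ u≡ (suc zero) = u≡

  -- Literal induction in the structure.

  module _ (l : Literal (Fin 2)) (a : Fun 0) where

    instantiate : Term (Fin 1) → Literal (Fin 1)
    instantiate t = l ⟨ t , const a ⟩

    stepFormula : Formula 1
    stepFormula = literal (instantiate (var zero)) ⇒ literal (instantiate (s (var zero)))

    At : Carrier → Set
    At x = Trueₗ (pair x (⟦ a ⟧ᶠ [])) l

    At-instantiate : ∀ x t → Trueₗ (λ _ → x) (instantiate t) ≡ At (value (λ _ → x) t)
    At-instantiate x t = Trueₗ-subst (value-pair _ ≡.refl ≡.refl) l

  -- A positive literal becomes false where its equation is left, a negative one where its equation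
  -- is entered.
  literal-turn : ∀ l a → At l a 0# → ∀ {x} → ¬ At l a x →
                 ∃[ c ] c ∈ turns (stepFormula l a) × At l a c × ¬ At l a (𝔸.s c)
  literal-turn l@(pos A) a T0 {x} ¬Tx =
    let c , c∈ , Tc , ¬Tsc = turnsₐ-leaving (substₐ _ A) (from 0# T0) (¬Tx ∘ to x)
    -- The candidates for l(x,a) form the left half of the list for the step formula.
    in  c , ∈-++⁺ˡ c∈ , to c Tc , ¬Tsc ∘ from (𝔸.s c)
    where
    to   = λ x → transport (At-instantiate l a x (var zero))
    from = λ x → transport⁻ (At-instantiate l a x (var zero))
  literal-turn l@(neg A) a T0 {x} ¬Tx =
    let c , c∈ , Tc , Tsc = turnsₐ-entering (substₐ _ A) (from 0# T0)
                              (decidable-stable (Trueₐ? _ (substₐ _ A)) (¬Tx ∘ to x))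
    in  c , ∈-++⁺ˡ c∈ , to c Tc , λ T → from (𝔸.s c) T Tsc
    where
    to   = λ x → transport (At-instantiate l a x (var zero))
    from = λ x → transport⁻ (At-instantiate l a x (var zero))

  -- A listed element violates the induction step, so the first counterexample in the list, which is
  -- the value of the Skolem constant, violates it as well. It need not be the element found by
  -- `literal-turn`.
  literal-induction : ∀ l a → At l a 0# → ∀ {x} → ¬ At l a x → let σ = ⟦skolem⟧ (stepFormula l a) in
                      At l a σ × ¬ At l a (𝔸.s σ)
  literal-induction l a T0 ¬Tx =
    let c , c∈ , Tc , ¬Tsc = literal-turn l a T0 ¬Tx
        Tσ , ¬Tsσ = ⇒-false⁻¹ L L′ (skolem-falsifies (stepFormula l a) (there (∈-++⁺ʳ witnesses c∈))
                      (⇒-false L L′ (transport⁻ (At-instantiate l a c (var zero)) Tc)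
                                    (¬Tsc ∘ transport (At-instantiate l a c (s (var zero))))))
    in  transport (At-instantiate l a _ (var zero)) Tσ ,
        ¬Tsσ ∘ transport⁻ (At-instantiate l a _ (s (var zero)))
    where
    L  = instantiate l a (var zero)
    L′ = instantiate l a (s (var zero))

  At? : ∀ l a x → Dec (At l a x)
  At? (pos A) a x = Trueₐ? _ A
  At? (neg A) a x = ¬? (Trueₐ? _ A)

  complement-false : ∀ {ρ : V → Carrier} l → Trueₗ ρ (complement l) → ¬ Trueₗ ρ l
  complement-false (pos A) ¬TA = ¬TA
  complement-false (neg A) TA  = λ ¬TA → ¬TA TA

  complement-true : ∀ {ρ : V → Carrier} l → ¬ Trueₗ ρ l → Trueₗ ρ (complement l)
  complement-true     (pos A) ¬TA  = ¬TA
  complement-true {ρ = ρ} (neg A) ¬¬TA = decidable-stable (Trueₐ? ρ A) ¬¬TA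

  -- Soundness of the induction rule and of deductions in the structure.

  module _ (l : Literal (Fin 2)) (a : Fun 0) (η : Fin 0 → ℕ) where
    private
      σ : Carrier
      σ = ⟦skolem⟧ (stepFormula l a)

      σₜ : Term (Fin 0)
      σₜ = skolemTerm all (substᶠ (lift var) (stepFormula l a))

      -- Skolemization leaves `lift var` in the index of the symbol; it acts as the identity, but
      -- has to be removed by a proof.
      value-σₜ : (ρ : Fin 0 → Carrier) → value ρ σₜ ≡ σ
      value-σₜ ρ = ≡.trans (value-skolemTerm ρ (substᶠ (lift var) (stepFormula l a)))
        (≡.cong ⟦skolem⟧ (substᶠ-var (lift-var λ _ → ≡.refl) (stepFormula l a)))

    -- An instance of l in the conclusion passes through three substitutions: formation of the
    -- induction premise, Skolemization, and naming of the clause variables.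
    conclusionLiteral : (Fin k → Term (Fin 0)) → Term (Fin k) → Literal ℕ
    conclusionLiteral τ t = substₗ (λ i → var (η i)) (substₗ τ (l ⟨ t , const a ⟩))

    At-conclusion : (ρ : ℕ → Carrier) (τ : Fin k → Term (Fin 0)) (t : Term (Fin k)) →
                    Trueₗ ρ (conclusionLiteral τ t) ≡ At l a (value (λ i → value none (τ i)) t)
    At-conclusion ρ τ t =
      ≡.trans (Trueₗ-subst {ρ′ = none} (λ ()) (substₗ τ (l ⟨ t , const a ⟩)))
      (≡.trans (Trueₗ-subst (λ _ → ≡.refl) (l ⟨ t , const a ⟩))
               (Trueₗ-subst (value-pair _ ≡.refl ≡.refl) l))

    conclusion : List Clause
    conclusion =
      (complement (conclusionLiteral var 𝟎) ∷ conclusionLiteral (σₜ ▸ var) (var zero) ∷ []) ∷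
      (complement (conclusionLiteral var 𝟎) ∷
       complement (conclusionLiteral (σₜ ▸ var) (s (var zero))) ∷ []) ∷
      []

    module _ {C : Clause} (premise : 𝔐 ⊨ᶜ (complement (l ⟨ const a , const a ⟩) ∷ C)) where

      -- The two conclusions differ only in `L`. If l(a,a) fails, then either l(0,a) fails or the
      -- induction step breaks at σ, which makes `L` true in both conclusions.
      resolve : ∀ L → (∀ ρ → At l a σ → ¬ At l a (𝔸.s σ) → Trueₗ ρ L) →
                𝔐 ⊨ᶜ (complement (conclusionLiteral var 𝟎) ∷ L ∷ C)
      resolve L L-true ρ ¬D = premise ρ refute
        where
        refute : ¬ Any (Trueₗ ρ) (complement (l ⟨ const a , const a ⟩) ∷ C)
        refute (there C-true) = ¬D (there (there C-true))
        refute (here ¬Taa) with At? l a 0#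
        ... | no ¬T0 = ¬D (here (complement-true (conclusionLiteral var 𝟎)
                                  (¬T0 ∘ transport (At-conclusion ρ var 𝟎))))
        ... | yes T0 = ¬D (there (here (L-true ρ (proj₁ turn) (proj₂ turn))))
          where
          turn = literal-induction l a T0 (complement-false (l ⟨ const a , const a ⟩) ¬Taa ∘
                                           transport⁻ (Trueₗ-subst (value-pair ρ ≡.refl ≡.refl) l))

      conclusion-sound : ∀ D → D ∈ conclusion ⊻ C → 𝔐 ⊨ᶜ D
      conclusion-sound _ (here ≡.refl) = resolve _ λ ρ Tσ _ →
        transport⁻ (At-conclusion ρ (σₜ ▸ var) (var zero))
          (≡.subst (At l a) (≡.sym (value-σₜ none)) Tσ)
      conclusion-sound _ (there (here ≡.refl)) = resolve _ λ ρ _ ¬Tsσ →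
        complement-true (conclusionLiteral (σₜ ▸ var) (s (var zero))) λ Tsσ →
          ¬Tsσ (≡.subst (λ y → At l a (𝔸.s y)) (value-σₜ none)
                  (transport (At-conclusion ρ (σₜ ▸ var) (s (var zero))) Tsσ))

  -- `clauses` is stuck until the sign of the literal is known; then both sides compute to the same
  -- list.
  cnf-inductionPremise : ∀ l a → cnf (neg (sk all (inductionPremise l a))) ≡ conclusion l a (λ ())
  cnf-inductionPremise (pos A) a = ≡.refl
  cnf-inductionPremise (neg A) a = ≡.refl

  aind-sound : ∀ {𝒞 ℬ} → LiteralAIND₂ 𝒞 ℬ → (∀ {C} → C ∈ᶜ 𝒞 → 𝔐 ⊨ᶜ C) → 𝔐 ⊨ˢ finite ℬ
  aind-sound (aind l a C C∈) ⊨𝒞 D D∈ =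
    conclusion-sound l a (λ ()) (⊨𝒞 C∈) D (≡.subst (λ 𝒟 → D ∈ 𝒟 ⊻ C) (cnf-inductionPremise l a) D∈)

  ∈ᶜ-sound : ∀ {𝒞 C} → 𝔐 ⊨ˢ 𝒞 → C ∈ᶜ 𝒞 → 𝔐 ⊨ᶜ C
  ∈ᶜ-sound ⊨𝒞 (D , D∈ , _ , D⊆C) ρ ¬C = ⊨𝒞 D D∈ ρ (¬C ∘ Any-resp-⊆ D⊆C)

  module _ {ℓ : Level} {S : SaturationSystem ℓ} (sound : Sound S) where

    -- The invariant is truth in the one structure `𝔐`, which rules of both systems preserve.
    deduction-sound : ∀ {𝒞 𝒟} → 𝔐 ⊨ˢ 𝒞 → Deduction (S + LiteralAIND₂) 𝒞 𝒟 → 𝔐 ⊨ˢ 𝒟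
    deduction-sound ⊨𝒞 start = ⊨𝒞
    deduction-sound ⊨𝒞 (step δ _ _) C (inj₁ C∈) = deduction-sound ⊨𝒞 δ C C∈
    deduction-sound ⊨𝒞 (step {𝒟} δ eq (inj₁ rule)) C (inj₂ C∈) =
      -- `Sound` speaks of derivations, so the rule is read as a one-step deduction from `𝒟`.
      proj₂ (sound 𝒟 C (_ , step start eq rule , C , inj₂ C∈ , ⊆-refl , ⊆-refl))
            𝔐 (deduction-sound ⊨𝒞 δ)
    deduction-sound ⊨𝒞 (step δ eq (inj₂ rule)) C (inj₂ C∈) =
      aind-sound rule (λ C∈𝒞 → ∈ᶜ-sound (deduction-sound ⊨𝒞 δ) (proj₁ eq _ C∈𝒞)) C C∈

    irrefutable : ∀ {𝒞} → 𝔐 ⊨ˢ 𝒞 → ¬ Refutes (S + LiteralAIND₂) 𝒞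
    irrefutable ⊨𝒞 (𝒟 , δ , []∈𝒟) = ∈ᶜ-sound (deduction-sound ⊨𝒞 δ) []∈𝒟 (λ _ → base) λ ()

  -- Truth of the axioms and of the two negated sentences.

  𝒯′-true : 𝔐 ⊨ˢ cnf-sk 𝒯′
  𝒯′-true _ (here ≡.refl) ρ ¬C = ¬C (here (𝔸.0≉s _))
  𝒯′-true _ (there (here ≡.refl)) ρ ¬C = ¬C (here 𝔸.p-0)
  𝒯′-true _ (there (there (here ≡.refl))) ρ ¬C = ¬C (here (𝔸.p-s _))
  𝒯′-true _ (there (there (there (here ≡.refl)))) ρ ¬C = ¬C (here (𝔸.+-identityʳ _))
  𝒯′-true _ (there (there (there (there (here ≡.refl))))) ρ ¬C = ¬C (here (+-s _ _))
  𝒯′-true _ (there (there (there (there (there (here ≡.refl)))))) ρ ¬C =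
    ¬C (there (here (𝔸.s-p (λ x≈0 → ¬C (here x≈0)))))
  𝒯′-true _ (there (there (there (there (there (there (here ≡.refl))))))) ρ ¬C =
    ¬C (here (𝔸.+-comm _ _))
  𝒯′-true _ (there (there (there (there (there (there (there (here ≡.refl)))))))) ρ ¬C =
    ¬C (here (𝔸.+-assoc _ _ _))
  𝒯′-true _ (there (there (there (there (there (there (there (there (here ≡.refl))))))))) ρ ¬C =
    ¬C (here (λ eq → ¬C (there (here (𝔸.+-cancelˡ _ eq)))))

  value-· : (ρ : V → Carrier) → ∀ m t → value ρ (m · t) ≈ m ⊗ value ρ t
  value-· ρ zero          t = 𝔸.refl
  value-· ρ (suc zero)    t = 𝔸.sym (𝔸.+-identityʳ _)
  value-· ρ (suc (suc m)) t = 𝔸.+-congˡ (value-· ρ (suc m) t)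

  value-s^ : (ρ : V → Carrier) → ∀ n t → value ρ (s^ n t) ≈ ⌜ n ⌝ 𝔸.+ value ρ t
  value-s^ ρ zero    t = 𝔸.sym (𝔸.+-identityˡ _)
  value-s^ ρ (suc n) t = 𝔸.trans (𝔸.+-congˡ (value-s^ ρ n t)) (𝔸.sym (𝔸.+-assoc 1# ⌜ n ⌝ _))

  module _ (B : Formula 2) where
    -- These replace x and y in the Skolemization of ¬∀x∀yB. The symbol in `c₂` is indexed by a
    -- formula that already contains `c₁`.
    c₁ c₂ : Term (Fin 0)
    c₁ = skolemTerm all (substᶠ (lift var) (quant all B))
    c₂ = skolemTerm all (substᶠ (lift (c₁ ▸ var)) B)

    remainder : Formula 1
    remainder = substᶠ (lift (c₁ ▸ var)) B

    -- `holds` rejects every element for the quantified index, so the head of the search list is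
    -- taken.
    value-c₁ : ∀ ρ → value ρ c₁ ≡ base
    value-c₁ ρ = value-skolemTerm ρ (substᶠ (lift var) (quant all B))

    Trueₐ-clause : ∀ (ρ : ℕ → Carrier) {η : Fin 0 → ℕ} A →
                   Trueₐ ρ (substₐ (λ i → var (η i)) (substₐ (c₂ ▸ c₁ ▸ var) A)) ≡
                   -- Index zero is the inner variable y, hence `base`, the value of x, comes
                   -- second.
                   Trueₐ (pair (⟦skolem⟧ remainder) base) A
    Trueₐ-clause ρ A = ≡.trans (Trueₐ-subst (λ _ → ≡.refl) (substₐ (c₂ ▸ c₁ ▸ var) A))
                               (Trueₐ-subst values≡ A)
      where
      values≡ : ∀ {ρ} i → value ρ ((c₂ ▸ c₁ ▸ var) i) ≡ pair (⟦skolem⟧ remainder) base i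
      values≡ zero       = value-skolemTerm _ remainder
      values≡ (suc zero) = value-c₁ _

    Trueₐ-remainder : ∀ x A → Trueₐ (λ _ → x) (substₐ (lift (c₁ ▸ var)) A) ≡ Trueₐ (pair x base) A
    Trueₐ-remainder x = Trueₐ-subst values≡
      where
      values≡ : ∀ i → value (λ _ → x) (lift (c₁ ▸ var) i) ≡ pair x base i
      values≡ zero       = ≡.refl
      values≡ (suc zero) = ≡.trans (value-subst {ρ′ = none} (λ ()) c₁) (value-c₁ none)

  module _ (m : ℕ) where
    private
      x y : Term (Fin 2)
      x = var (suc zero)
      y = var zero

    -- With x denoting `base`, the element `c` falsifies the remaining formula in y. The value of
    -- the second Skolem constant then falsifies it too, whether or not it is `c`.
    𝒳-true : ∀ {c} → c ∈ witnesses → m ⊗ base ≈ m ⊗ c → ¬ base ≈ c → 𝔐 ⊨ˢ 𝒳 m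
    𝒳-true {c} c∈ m⊗base≈m⊗c base≉c = λ where
        _ (here ≡.refl) ρ ¬C →
          ¬C (here (transport⁻ (Trueₐ-clause B ρ mx≐my) (proj₁ instances)))
        _ (there (here ≡.refl)) ρ ¬C →
          ¬C (here (proj₂ instances ∘ transport (Trueₐ-clause B ρ x≐y)))
        C (there (there C∈)) → 𝒯′-true C C∈
      where
      mx≐my x≐y : Atom (Fin 2)
      mx≐my = m · x ≐ m · y
      x≐y   = x ≐ y

      B : Formula 2
      B = atom mx≐my ⇒ atom x≐y

      d : Carrier
      d = ⟦skolem⟧ (remainder B)

      L L′ : Literal (Fin 1)
      L  = pos (substₐ (lift (c₁ B ▸ var)) mx≐my)
      L′ = pos (substₐ (lift (c₁ B ▸ var)) x≐y)

      mx≐my-at-c : Trueₐ (pair c base) mx≐my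
      mx≐my-at-c = 𝔸.trans (value-· (pair c base) m x)
                   (𝔸.trans m⊗base≈m⊗c (𝔸.sym (value-· (pair c base) m y)))

      instances : Trueₐ (pair d base) mx≐my × ¬ Trueₐ (pair d base) x≐y
      instances =
        let T , ¬T = ⇒-false⁻¹ L L′ (skolem-falsifies (remainder B) (there (∈-++⁺ˡ c∈))
                       (⇒-false L L′ (transport⁻ (Trueₐ-remainder B c mx≐my) mx≐my-at-c)
                                     (base≉c ∘ transport (Trueₐ-remainder B c x≐y))))
        in  transport (Trueₐ-remainder B d mx≐my) T , ¬T ∘ transport⁻ (Trueₐ-remainder B d x≐y)

    𝒴-true : ∀ n {c} → c ∈ witnesses → ⌜ n ⌝ 𝔸.+ m ⊗ base ≈ m ⊗ c → 𝔐 ⊨ˢ 𝒴 m n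
    𝒴-true n {c} c∈ n+m⊗base≈m⊗c = λ where
        _ (here ≡.refl) ρ ¬C → ¬C (here (transport⁻ (Trueₐ-clause B ρ A) A-at-d))
        C (there C∈)       → 𝒯′-true C C∈
      where
      A : Atom (Fin 2)
      A = s^ n (m · x) ≐ m · y

      B : Formula 2
      B = neg (atom A)

      d : Carrier
      d = ⟦skolem⟧ (remainder B)

      L : Literal (Fin 1)
      L = neg (substₐ (lift (c₁ B ▸ var)) A)

      A-at-c : Trueₐ (pair c base) A
      A-at-c = 𝔸.trans (value-s^ (pair c base) n (m · x))
               (𝔸.trans (𝔸.+-congˡ (value-· (pair c base) m x))
               (𝔸.trans n+m⊗base≈m⊗c (𝔸.sym (value-· (pair c base) m y))))

      L-false : holds (literal L) d ≡ false
      L-false = skolem-falsifies (remainder B) (there (∈-++⁺ˡ c∈))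
        (det (holds-reflects L c) (ofⁿ λ ¬T → ¬T (transport⁻ (Trueₐ-remainder B c A) A-at-c)))

      A-at-d : Trueₐ (pair d base) A
      A-at-d = decidable-stable (Trueₐ? _ A) λ ¬T →
        invert (≡.subst (Reflects (Trueₗ (λ _ → d) L)) L-false (holds-reflects L d))
               (¬T ∘ transport (Trueₐ-remainder B d A))

theorem6 : ∀ {a : Level} (𝔏 : Signature) → let open FirstOrder 𝔏 in
    (S : SaturationSystem a) → Sound S → RefutationallyComplete S →
    (m n : ℕ) → 0 < n → n < m →
    ¬ Refutes (S + LiteralAIND₂) (𝒳 m) × ¬ Refutes (S + LiteralAIND₂) (𝒴 m n)
theorem6 𝔏 S sound _ m n 0<n n<m =
    irrefutable sound (𝒳-true m (here ≡.refl) m⊗base≈m⊗torsion base≉torsion) ,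
    irrefutable sound (𝒴-true m n (there (here ≡.refl)) (n+m⊗base≈m⊗shifted n))
  where
  -- From `0 < n` and `n < m` follows `1 < m`, so ℤ/m is nontrivial.
  open NonstandardModel m (ℕ.≤-<-trans 0<n n<m)
  open Interpretation 𝔏 arithmetic base (torsion ∷ shifted n ∷ [])
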